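{- Let $A$ be a set of integers, each at least $3$, let $\mathcal C_A=\{C_a:a\in A\}$ and let $A_e$ be the set of even elements of $A$. Then, for $k\ge 3$, as $n\to\infty$: $ex(n,C_4,\mathcal C_A)=0$ if $4\in A$; $ex(n,C_4,\mathcal C_A)=(1+o(1))\frac{(k-1)(k-2)}{4}n^2$ if $4\notin A$ and $2k$ is the smallest element of $A_e$; $ex(n,C_4,\mathcal C_A)=(1+o(1))\frac{1}{64}n^4$ if $A_e=\emptyset$.
   Context: $C_k$ denotes the cycle with $k$ vertices. For a graph $H$ and a family of graphs $\mathcal F$, $ex(n,H,\mathcal F)$ is the maximum number of subgraphs isomorphic to $H$ in an $n$-vertex graph containing no member of $\mathcal F$ as a subgraph.
   Formalization: In the third case A is assumed nonempty, since for A = ∅ nothing is forbidden and ex(n,C_4,∅) = 3·C(n,4) ~ n^4/8, so the claim as stated fails. -}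

module Defs where

open import Level using (0ℓ)
open import Data.Bool using (true; false)
open import Data.Empty using (⊥; ⊥-elim)
open import Data.Fin using (Fin; zero; suc; toℕ)
import Data.Fin.Properties as Fin
open import Data.Fin.Subset using (Subset; _∈_)
open import Data.Fin.Subset.Properties using (_∈?_)
open import Data.Integer using (+_)
open import Data.List as List using (List; []; _∷_; length; filter; cartesianProductWith)
open import Data.List.Membership.Propositional as List using (find; lose)
open import Data.List.Membership.Propositional.Properties
  using (∈-allFin; ∈-cartesianProductWith⁺)
open import Data.List.Properties using (length-filter; filter-≐)
open import Data.List.Relation.Unary.All as All using ([]; _∷_)
open import Data.List.Relation.Unary.AllPairs using ([]; _∷_)
open import Data.List.Relation.Unary.Any as Any using (here; there)
open import Data.List.Relation.Unary.Unique.Propositional using (Unique)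
open import Data.List.Relation.Unary.Unique.Propositional.Properties
  using (cartesianProductWith⁺)
open import Data.Nat using (ℕ; zero; suc; _≤_; _<_; _≥_; z≤n; s≤s)
open import Data.Nat.Divisibility using (_∣_)
import Data.Nat.Properties as ℕ
open import Data.Product using (∃; ∃-syntax; Σ-syntax; _×_; _,_; proj₁; proj₂)
open import Data.Rational as ℚ using (ℚ; 0ℚ; 1ℚ)
open import Data.Sum using (_⊎_; inj₁; inj₂; swap)
open import Data.Vec using (Vec; []; _∷_; lookup; tabulate)
open import Data.Vec.Properties
  using (∷-injective; lookup∘tabulate; []=⇒lookup; lookup⇒[]=)
open import Function using (_∘_)
open import Function.Bundles using (_⇔_; mk⇔; Equivalence)
open import Function.Definitions using (Injective)
open import Relation.Binary using (Rel; Symmetric; Irreflexive)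
import Relation.Binary.Definitions as B
open import Relation.Binary.PropositionalEquality as ≡
  using (_≡_; _≢_; _≗_; refl; trans; cong; subst; subst₂)
open import Relation.Nullary using (¬_; Dec; yes; no; does)
open import Relation.Nullary.Decidable
  using (map′; ¬?; _×-dec_; _⊎-dec_; _→-dec_; dec-true)
open import Relation.Unary using (Pred; Decidable)

record Graph (n : ℕ) : Set₁ where
  field
    Adj    : Rel (Fin n) 0ℓ
    adj?   : B.Decidable Adj
    sym    : Symmetric Adj
    irrefl : Irreflexive _≡_ Adj

FinGraph : Set₁
FinGraph = ∃ Graph

Successive : ∀ {k} → Rel (Fin k) 0ℓ
Successive {k} i j = suc (toℕ i) ≡ toℕ j ⊎ (suc (toℕ i) ≡ k × toℕ j ≡ 0)

-- The condition i ≢ j follows from the other one when k ≥ 2; it only makes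
-- the definition total.
cycle : ∀ k → Graph k
cycle k = record
  { Adj    = λ i j → i ≢ j × (Successive i j ⊎ Successive j i)
  ; adj?   = λ i j → ¬? (i Fin.≟ j) ×-dec (successive? i j ⊎-dec successive? j i)
  ; sym    = λ (i≢j , s) → (i≢j ∘ ≡.sym) , swap s
  ; irrefl = λ i≡j (i≢j , _) → i≢j i≡j
  }
  where
  successive? : B.Decidable (Successive {k})
  successive? i j =
    (suc (toℕ i) ℕ.≟ toℕ j) ⊎-dec ((suc (toℕ i) ℕ.≟ k) ×-dec (toℕ j ℕ.≟ 0))

-- A vertex set together with an edge set, the latter given by the rows of
-- its adjacency matrix.  Being first-order data, distinct subgraphs are
-- exactly the propositionally distinct elements of this type.
record Subgraph (n : ℕ) : Set where
  constructor subgraph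
  field
    vertices : Subset n
    rows     : Vec (Subset n) n

  Edge : Rel (Fin n) 0ℓ
  Edge i j = j ∈ lookup rows i

open Subgraph

record _⊑_ {n} (S : Subgraph n) (G : Graph n) : Set where
  field
    symmetric : ∀ i j → Edge S i j → Edge S j i
    endpoints : ∀ i j → Edge S i j → i ∈ vertices S × j ∈ vertices S
    edges     : ∀ i j → Edge S i j → Graph.Adj G i j

record _≅_ {m n} (H : Graph m) (S : Subgraph n) : Set where
  field
    to        : Fin m → Fin n
    injective : Injective _≡_ _≡_ to
    image     : ∀ v → v ∈ vertices S ⇔ (∃[ i ] to i ≡ v)
    adjacency : ∀ i j → Graph.Adj H i j ⇔ Edge S (to i) (to j)

IsCopy : ∀ {m n} → Graph m → Graph n → Pred (Subgraph n) 0ℓ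
IsCopy H G S = S ⊑ G × H ≅ S

-- Containment as a not necessarily induced subgraph.
Contains : ∀ {m n} → Graph n → Graph m → Set
Contains G H = ∃ (IsCopy H G)

Free : ∀ {n} {I : Set} → (I → FinGraph) → Graph n → Set
Free 𝓕 G = ∀ i → ¬ Contains G (proj₂ (𝓕 i))

allVecs : ∀ {A : Set} → List A → ∀ n → List (Vec A n)
allVecs xs zero    = [] ∷ []
allVecs xs (suc n) = cartesianProductWith _∷_ xs (allVecs xs n)

allSubsets : ∀ n → List (Subset n)
allSubsets = allVecs (true ∷ false ∷ [])

allSubgraphs : ∀ n → List (Subgraph n)
allSubgraphs n =
  cartesianProductWith subgraph (allSubsets n) (allVecs (allSubsets n) n)

allVecs-complete : ∀ {A : Set} {xs : List A} → (∀ x → x List.∈ xs) →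
                   ∀ {n} (v : Vec A n) → v List.∈ allVecs xs n
allVecs-complete c []      = here refl
allVecs-complete c (x ∷ v) =
  ∈-cartesianProductWith⁺ _∷_ (c x) (allVecs-complete c v)

allVecs-unique : ∀ {A : Set} {xs : List A} → Unique xs →
                 ∀ n → Unique (allVecs xs n)
allVecs-unique u zero    = [] ∷ []
allVecs-unique u (suc n) =
  cartesianProductWith⁺ _∷_ ∷-injective u (allVecs-unique u n)

allSubsets-complete : ∀ {n} (p : Subset n) → p List.∈ allSubsets n
allSubsets-complete = allVecs-complete λ
  { true → here refl ; false → there (here refl) }

allSubsets-unique : ∀ n → Unique (allSubsets n)
allSubsets-unique = allVecs-unique (((λ ()) ∷ []) ∷ [] ∷ [])

allSubgraphs-complete : ∀ {n} (S : Subgraph n) → S List.∈ allSubgraphs n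
allSubgraphs-complete (subgraph V E) = ∈-cartesianProductWith⁺ subgraph
  (allSubsets-complete V) (allVecs-complete allSubsets-complete E)

allSubgraphs-unique : ∀ n → Unique (allSubgraphs n)
allSubgraphs-unique n = cartesianProductWith⁺ subgraph (λ { refl → refl , refl })
  (allSubsets-unique n) (allVecs-unique (allSubsets-unique n) n)

⇔-dec : ∀ {A B : Set} → Dec A → Dec B → Dec (A ⇔ B)
⇔-dec a? b? = map′ (λ (f , g) → mk⇔ f g)
  (λ e → Equivalence.to e , Equivalence.from e)
  ((a? →-dec b?) ×-dec (b? →-dec a?))

anyFunction? : ∀ {m n} {P : Pred (Fin m → Fin n) 0ℓ} →
               (∀ {f g} → f ≗ g → P f → P g) → Decidable P → Dec (∃ P)
anyFunction? {m} {n} resp P? = map′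
  (λ a → let (v , _ , p) = find a in lookup v , p)
  (λ (f , p) → lose (allVecs-complete ∈-allFin (tabulate f))
                    (resp (λ i → ≡.sym (lookup∘tabulate f i)) p))
  (Any.any? (λ v → P? (lookup v)) (allVecs (List.allFin n) m))

edge? : ∀ {n} (S : Subgraph n) → B.Decidable (Edge S)
edge? S i j = j ∈? lookup (rows S) i

_⊑?_ : ∀ {n} (S : Subgraph n) (G : Graph n) → Dec (S ⊑ G)
S ⊑? G = map′
  (λ (s , v , e) → record { symmetric = s ; endpoints = v ; edges = e })
  (λ c → let open _⊑_ c in symmetric , endpoints , edges)
  (all₂? (λ i j → edge? S i j →-dec edge? S j i)
   ×-dec all₂? (λ i j → edge? S i j →-dec ((i ∈? vertices S) ×-dec (j ∈? vertices S)))
   ×-dec all₂? (λ i j → edge? S i j →-dec Graph.adj? G i j))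
  where
  all₂? : ∀ {n} {R : Rel (Fin n) 0ℓ} → B.Decidable R → Dec (∀ i j → R i j)
  all₂? R? = Fin.all? λ i → Fin.all? λ j → R? i j

_≅?_ : ∀ {m n} (H : Graph m) (S : Subgraph n) → Dec (H ≅ S)
_≅?_ {m} {n} H S = map′
  (λ (f , inj , im , ad) → record
    { to = f ; injective = λ {i} {j} → inj i j ; image = im ; adjacency = ad })
  (λ c → let open _≅_ c in to , (λ i j → injective) , image , adjacency)
  (anyFunction? resp iso?)
  where
  IsIso : Pred (Fin m → Fin n) 0ℓ
  IsIso f = (∀ i j → f i ≡ f j → i ≡ j)
          × (∀ v → v ∈ vertices S ⇔ (∃[ i ] f i ≡ v))
          × (∀ i j → Graph.Adj H i j ⇔ Edge S (f i) (f j))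

  iso? : Decidable IsIso
  iso? f =
    (Fin.all? λ i → Fin.all? λ j → (f i Fin.≟ f j) →-dec (i Fin.≟ j))
    ×-dec (Fin.all? λ v → ⇔-dec (v ∈? vertices S) (Fin.any? λ i → f i Fin.≟ v))
    ×-dec (Fin.all? λ i → Fin.all? λ j →
             ⇔-dec (Graph.adj? H i j) (edge? S (f i) (f j)))

  resp : ∀ {f g} → f ≗ g → IsIso f → IsIso g
  resp f≗g (inj , im , ad) =
    (λ i j e → inj i j (trans (f≗g i) (trans e (≡.sym (f≗g j)))))
    , (λ v → mk⇔
        (λ v∈ → let (i , e) = Equivalence.to (im v) v∈
                in i , trans (≡.sym (f≗g i)) e)
        (λ (i , e) → Equivalence.from (im v) (i , trans (f≗g i) e)))
    , (λ i j → mk⇔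
        (λ a → subst₂ (Edge S) (f≗g i) (f≗g j) (Equivalence.to (ad i j) a))
        (λ a → Equivalence.from (ad i j)
                 (subst₂ (Edge S) (≡.sym (f≗g i)) (≡.sym (f≗g j)) a)))

isCopy? : ∀ {m n} (H : Graph m) (G : Graph n) → Decidable (IsCopy H G)
isCopy? H G S = (S ⊑? G) ×-dec (H ≅? S)

copies : ∀ {m n} → Graph m → Graph n → ℕ
copies {n = n} H G = length (filter (isCopy? H G) (allSubgraphs n))

-- ex(n, H, 𝓕) = m.  A relation, because for an undecidable family the maximum
-- cannot be computed; see IsEx-unique and IsEx-exists.
record IsEx {h} {I : Set} (n : ℕ) (H : Graph h) (𝓕 : I → FinGraph) (m : ℕ)
            : Set₁ where
  field
    attained : Σ[ G ∈ Graph n ] (Free 𝓕 G × copies H G ≡ m)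
    maximal  : ∀ (G : Graph n) → Free 𝓕 G → copies H G ≤ m

cycles : (A : Pred ℕ 0ℓ) → ∃ A → FinGraph
cycles A (a , _) = a , cycle a

Even : Pred ℕ 0ℓ
Even a = 2 ∣ a

IsLeast : ℕ → Pred ℕ 0ℓ → Set
IsLeast m A = A m × (∀ {a} → A a → m ≤ a)

fromℕ : ℕ → ℚ
fromℕ n = + n ℚ./ 1

TendsToZero : (ℕ → ℚ) → Set
TendsToZero δ =
  ∀ ε → 0ℚ ℚ.< ε → ∃[ N ] (∀ n → n ≥ N → ℚ.∣ δ n ∣ ℚ.< ε)

-- f(n) = (1 + o(1)) g(n) as n → ∞.
_∼_ : (ℕ → ℕ) → (ℕ → ℚ) → Set
f ∼ g = ∃[ δ ] TendsToZero δ ×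
  (∃[ N ] (∀ n → n ≥ N → fromℕ (f n) ≡ (1ℚ ℚ.+ δ n) ℚ.* g n))

IsEx-unique : ∀ {h} {I : Set} {n} {H : Graph h} {𝓕 : I → FinGraph} {m m′} →
              IsEx n H 𝓕 m → IsEx n H 𝓕 m′ → m ≡ m′
IsEx-unique e e′ = ℕ.≤-antisym (below e e′) (below e′ e)
  where
  below : ∀ {h} {I : Set} {n} {H : Graph h} {𝓕 : I → FinGraph} {m m′} →
          IsEx n H 𝓕 m → IsEx n H 𝓕 m′ → m ≤ m′
  below record { attained = G , free , refl } e′ = IsEx.maximal e′ G free

_≈ᴳ_ : ∀ {n} → Graph n → Graph n → Set
G ≈ᴳ G′ = ∀ i j → Graph.Adj G i j ⇔ Graph.Adj G′ i j

≈ᴳ-sym : ∀ {n} {G G′ : Graph n} → G ≈ᴳ G′ → G′ ≈ᴳ G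
≈ᴳ-sym e i j = mk⇔ (Equivalence.from (e i j)) (Equivalence.to (e i j))

isCopy-resp : ∀ {m n} {H : Graph m} {G G′ : Graph n} → G ≈ᴳ G′ →
              ∀ {S} → IsCopy H G S → IsCopy H G′ S
isCopy-resp e (s , iso) = record
  { symmetric = symmetric ; endpoints = endpoints
  ; edges = λ i j x → Equivalence.to (e i j) (edges i j x) } , iso
  where open _⊑_ s

copies-resp : ∀ {m n} {H : Graph m} {G G′ : Graph n} → G ≈ᴳ G′ →
              copies H G ≡ copies H G′
copies-resp {n = n} {H} {G} {G′} e = cong length
  (filter-≐ (isCopy? H G) (isCopy? H G′)
    (isCopy-resp {H = H} {G} {G′} e
    , isCopy-resp {H = H} {G′} {G} (≈ᴳ-sym {G = G} {G′} e))
    (allSubgraphs n))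

free-resp : ∀ {n} {I : Set} {𝓕 : I → FinGraph} {G G′ : Graph n} → G ≈ᴳ G′ →
            Free 𝓕 G → Free 𝓕 G′
free-resp {𝓕 = 𝓕} {G} {G′} e free i (S , c) =
  free i (S , isCopy-resp {H = proj₂ (𝓕 i)} {G′} {G} (≈ᴳ-sym {G = G} {G′} e) c)

AdjMatrix : ℕ → Set
AdjMatrix n = Vec (Subset n) n

matrixGraph : ∀ {n} → AdjMatrix n → Graph n
matrixGraph M = record
  { Adj    = λ i j → i ≢ j × (j ∈ lookup M i × i ∈ lookup M j)
  ; adj?   = λ i j → ¬? (i Fin.≟ j) ×-dec
                     ((j ∈? lookup M i) ×-dec (i ∈? lookup M j))
  ; sym    = λ (i≢j , a , b) → (i≢j ∘ ≡.sym) , b , a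
  ; irrefl = λ i≡j (i≢j , _) → i≢j i≡j
  }

matrix : ∀ {n} → Graph n → AdjMatrix n
matrix G = tabulate λ i → tabulate λ j → does (Graph.adj? G i j)

lookup-matrix : ∀ {n} (G : Graph n) i j →
                lookup (lookup (matrix G) i) j ≡ does (Graph.adj? G i j)
lookup-matrix G i j = trans
  (cong (λ r → lookup r j) (lookup∘tabulate _ i)) (lookup∘tabulate _ j)

matrix⁺ : ∀ {n} (G : Graph n) {i j} → Graph.Adj G i j → j ∈ lookup (matrix G) i
matrix⁺ G {i} {j} a = lookup⇒[]= j _
  (trans (lookup-matrix G i j) (dec-true (Graph.adj? G i j) a))

matrix⁻ : ∀ {n} (G : Graph n) {i j} → j ∈ lookup (matrix G) i → Graph.Adj G i j
matrix⁻ G {i} {j} m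
  with Graph.adj? G i j | trans (≡.sym (lookup-matrix G i j)) ([]=⇒lookup m)
... | yes a | _ = a
... | no _  | ()

matrix-≈ᴳ : ∀ {n} (G : Graph n) → G ≈ᴳ matrixGraph (matrix G)
matrix-≈ᴳ G i j = mk⇔
  (λ a → (λ e → Graph.irrefl G e a) , matrix⁺ G a , matrix⁺ G (Graph.sym G a))
  (λ (_ , a , _) → matrix⁻ G a)

maximumOn : ∀ {A : Set} {P : Pred A 0ℓ} → Decidable P → (f : A → ℕ) →
            (xs : List A) →
            (∀ {x} → x List.∈ xs → ¬ P x) ⊎
            (∃[ x ] P x × (∀ {y} → y List.∈ xs → P y → f y ≤ f x))
maximumOn P? f [] = inj₁ λ ()
maximumOn P? f (x ∷ xs) with P? x | maximumOn P? f xs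
... | no ¬p | inj₁ none = inj₁ λ { (here refl) → ¬p ; (there y) → none y }
... | no ¬p | inj₂ (z , pz , z-max) = inj₂ (z , pz , λ
  { (here refl) p → ⊥-elim (¬p p) ; (there y) → z-max y })
... | yes p | inj₁ none = inj₂ (x , p , λ
  { (here refl) _ → ℕ.≤-refl ; (there y) py → ⊥-elim (none y py) })
... | yes p | inj₂ (z , pz , z-max) with ℕ.≤-total (f x) (f z)
...   | inj₁ x≤z = inj₂ (z , pz , λ
  { (here refl) _ → x≤z ; (there y) → z-max y })
...   | inj₂ z≤x = inj₂ (x , p , λ
  { (here refl) _ → ℕ.≤-refl ; (there y) py → ℕ.≤-trans (z-max y py) z≤x })

contains? : ∀ {m n} (G : Graph n) (H : Graph m) → Dec (Contains G H)
contains? {n = n} G H = map′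
  (λ a → let (S , _ , c) = find a in S , c)
  (λ (S , c) → lose (allSubgraphs-complete S) c)
  (Any.any? (isCopy? H G) (allSubgraphs n))

cycles-free? : ∀ {A : Pred ℕ 0ℓ} → Decidable A →
               ∀ {n} (G : Graph n) → Dec (Free (cycles A) G)
cycles-free? {A} A? {n} G =
  map′ to from (¬? (ℕ.anyUpTo? contained? (suc n)))
  where
  ContainedIn : Pred ℕ 0ℓ
  ContainedIn a = A a × Contains G (cycle a)

  contained? : Decidable ContainedIn
  contained? a = A? a ×-dec contains? G (cycle a)

  to : ¬ (∃[ a ] a < suc n × ContainedIn a) → Free (cycles A) G
  to none (a , a∈A) c@(_ , _ , iso) =
    none (a , s≤s (Fin.injective⇒≤ (_≅_.injective iso)) , a∈A , c)

  from : Free (cycles A) G → ¬ (∃[ a ] a < suc n × ContainedIn a)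
  from free (a , _ , a∈A , c) = free (a , a∈A) c

edgeless : ∀ n → Graph n
edgeless n = record
  { Adj = λ _ _ → ⊥ ; adj? = λ _ _ → no λ () ; sym = λ ()
  ; irrefl = λ _ () }

edgeless-free : ∀ {A : Pred ℕ 0ℓ} → (∀ {a} → A a → 3 ≤ a) →
                ∀ n → Free (cycles A) (edgeless n)
edgeless-free A≥3 n (a , a∈A) (S , sub , iso) with A≥3 a∈A
... | s≤s (s≤s (s≤s _)) = _⊑_.edges sub _ _
  (Equivalence.to (_≅_.adjacency iso zero (suc zero))
    ((λ ()) , inj₁ (inj₁ refl)))

IsEx-exists : ∀ {A : Pred ℕ 0ℓ} → Decidable A → (∀ {a} → A a → 3 ≤ a) →
              ∀ {h} (H : Graph h) n → ∃ (IsEx n H (cycles A))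
IsEx-exists {A} A? A≥3 H n
  with maximumOn (λ M → cycles-free? A? (matrixGraph M))
               (λ M → copies H (matrixGraph M)) (allVecs (allSubsets n) n)
... | inj₁ none = ⊥-elim (none
  (allVecs-complete allSubsets-complete (matrix (edgeless n)))
  (free-resp {G = edgeless n} {matrixGraph (matrix (edgeless n))}
    (matrix-≈ᴳ (edgeless n)) (edgeless-free A≥3 n)))
... | inj₂ (M , free , M-max) = copies H (matrixGraph M) , record
  { attained = matrixGraph M , free , refl
  ; maximal  = λ G G-free → subst (_≤ copies H (matrixGraph M))
      (≡.sym (copies-resp {H = H} {G} {matrixGraph (matrix G)} (matrix-≈ᴳ G)))
      (M-max (allVecs-complete allSubsets-complete (matrix G))
        (free-resp {G = G} {matrixGraph (matrix G)} (matrix-≈ᴳ G) G-free))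
  }

-- Call Q the number of ordered quadruples a ≠ c, b ≠ d with a, c both adjacent
-- to b, d; then 8 · #C₄ ≤ Q.
--
-- No C_{2k}: if at most k − 1 vertices are adjacent to both a and c, the pair
-- a, c contributes at most (k − 1)(k − 2) to Q, and likewise for b, d; this
-- gives 2(k − 1)(k − 2)n².  The remaining fat quadruples, where both pairs have
-- at least k common neighbours, number O(e) for e the number of edges.
-- Otherwise, discarding repeatedly the edges in few fat quadruples leaves an
-- edge a b that can be grown, two vertices at a time, to a C_{2k}: a fat
-- quadruple on a path from b to a with closing edge a b replaces a b by a d and
-- lengthens the path by c and d.  If c is already on the path, another common
-- neighbour of b and d takes its place, unless for many d all of them are on
-- the path, which yields a K_{k,k}.  Finally e⁴ ≤ n⁴ · O(n³) by Cauchy–Schwarz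
-- twice, so e = o(n²).  The lower bound is K_{k−1,n−k+1}.
--
-- No C_a with a odd: the neighbourhood of a vertex contains no path on a − 1
-- vertices, so it spans O(n) edges and there are O(n²) triangles.  Then
-- e ≤ n²/2 + O(n) for the number e of ordered edges, and 2Q ≤ e² + O(n³).
-- The lower bound is K_{⌊n/2⌋,⌈n/2⌉}.
{-# OPTIONS --safe #-}
module Submission where

open import Defs
open import Level using (0ℓ)
open import Data.Bool using (Bool; true; false; not)
import Data.Bool.Properties as Bool
open import Data.Empty using (⊥)
open import Data.Fin as Fin using (Fin; zero; suc; toℕ; fromℕ<)
import Data.Fin.Properties as Fin
open import Data.Fin.Subset using (Subset)
import Data.Fin.Subset as Subset
import Data.Fin.Subset.Properties as Subset
open import Data.Integer as ℤ using (+_)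
import Data.Integer.Properties as ℤ
import Data.Integer.Tactic.RingSolver as ℤ-Solver
open import Data.List using (List; []; _∷_; _++_; length; filter; map; allFin; cartesianProduct; take; reverse) renaming (lookup to lookupˡ)
import Data.List.Properties as List
open import Data.List.Membership.Propositional using (find; lose)
  renaming (_∈_ to _∈ˡ_; _∉_ to _∉ˡ_)
import Data.List.Membership.Propositional.Properties as List
import Data.List.Relation.Binary.Permutation.Setoid as Permutation
import Data.List.Relation.Binary.Permutation.Setoid.Properties as Permutation
open import Data.List.Relation.Unary.All as All using ([]; _∷_)
open import Data.List.Relation.Unary.AllPairs using ([]; _∷_)
open import Data.List.Relation.Unary.Any as Any using (here; there)
open import Data.List.Relation.Unary.Unique.Propositional using (Unique)
import Data.List.Relation.Unary.Any.Properties as Any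
import Data.List.Relation.Unary.Unique.Propositional.Properties as Unique
open import Data.Nat using (ℕ; zero; suc; _+_; _≤_; _<_; _*_; _∸_; _^_; z≤n; s≤s; z<s; s<s; s<s⁻¹; ⌊_/2⌋; ⌈_/2⌉)
open import Data.Nat.Coprimality using (Coprime)
open import Data.Nat.Divisibility using (_∣_; divides)
import Data.Nat.Properties as ℕ
open import Data.Nat.Tactic.RingSolver using (solve-∀)
open import Data.Product using (∃-syntax; Σ-syntax; _×_; _,_; proj₁; proj₂)
open import Data.Rational as ℚ using (ℚ; 0ℚ; 1ℚ; _/_)
import Data.Rational.Properties as ℚ
open import Data.Rational.Unnormalised as ℚᵘ using (mkℚᵘ)
import Data.Rational.Unnormalised.Properties as ℚᵘ
open import Data.Sum as Sum using (_⊎_; inj₁; inj₂; [_,_]′)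
open import Data.Vec using (Vec; lookup; tabulate)
import Data.Vec.Properties as Vec
open import Function using (_∘_; id)
open import Function.Bundles using (_⇔_; mk⇔; Equivalence)
open import Function.Definitions using (Injective)
open import Relation.Binary.Definitions using () renaming (Decidable to Decidable₂)
open import Relation.Binary using (tri<; tri≈; tri>)
open import Relation.Binary.PropositionalEquality
  using (_≡_; _≢_; refl; sym; trans; setoid; cong; cong₂; subst; subst₂; module ≡-Reasoning)
open import Relation.Nullary using (¬_; Dec; yes; no; does; contradiction)
open import Relation.Nullary.Decidable using (¬?; _×-dec_; _⊎-dec_; _→-dec_; map′; dec-true; dec-false; decidable-stable; from-yes)
open import Relation.Unary using (Pred; Decidable; _∈_; _∉_; _∩_; Empty; Satisfiable)

-- Both opposite pairs of a quadruple must be fat because the path may have to grow at either end.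
-- If only the neighbour of `b` in the quadruple is already used, the path is prolonged beyond `b`
-- and `a d` closes it; if only the neighbour of `a` is used, the reversed path is prolonged beyond
-- `a` and `c b` closes it. So both `a d` and `c b` have to survive the discarding.
--
-- The discarding is cut into k - 1 rounds: a single edge is a path on two vertices, and k - 1
-- growths by two vertices reach exactly 2k. A round costs at most 2θe fat quadruples, where θ
-- depends on k alone.
--
-- The fat term is linear in e, so it is negligible only once e = o(n²). There is no circle in this:
-- the trivial e ≤ n² already gives Q = O(n²), the degenerate closed walks of length four add O(n³),
-- and Cauchy-Schwarz needs no more.
--
-- Limits are avoided until the very end. Every estimate compares natural numbers up to an error n^p
-- after multiplication by an arbitrary t, which plays the role of 1/ε.

private variable
  X Y : Set
  P Q R : Set

-- Finite sums over lists.

∑ : List X → (X → ℕ) → ℕ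
∑ []       f = 0
∑ (x ∷ xs) f = f x + ∑ xs f

infix 5 ∑
syntax ∑ xs (λ x → e) = ∑[ x ← xs ] e

∑-mono-∈ : ∀ {f g : X → ℕ} xs → (∀ {x} → x ∈ˡ xs → f x ≤ g x) → ∑ xs f ≤ ∑ xs g
∑-mono-∈ []       h = z≤n
∑-mono-∈ (x ∷ xs) h = ℕ.+-mono-≤ (h (here refl)) (∑-mono-∈ xs (h ∘ there))

∑-mono : ∀ {f g : X → ℕ} xs → (∀ x → f x ≤ g x) → ∑ xs f ≤ ∑ xs g
∑-mono xs h = ∑-mono-∈ xs λ _ → h _

∑-cong : ∀ {f g : X → ℕ} xs → (∀ x → f x ≡ g x) → ∑ xs f ≡ ∑ xs g
∑-cong []       h = refl
∑-cong (x ∷ xs) h = cong₂ _+_ (h x) (∑-cong xs h)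

∑-+ : ∀ (f g : X → ℕ) xs → ∑ xs (λ x → f x + g x) ≡ ∑ xs f + ∑ xs g
∑-+ f g []       = refl
∑-+ f g (x ∷ xs) = trans (cong (_+_ (f x + g x)) (∑-+ f g xs))
  (interchange (f x) (g x) (∑ xs f) (∑ xs g))
  where
  interchange : ∀ a b c d → a + b + (c + d) ≡ a + c + (b + d)
  interchange = solve-∀

∑-*ˡ : ∀ c (f : X → ℕ) xs → ∑ xs (λ x → c * f x) ≡ c * ∑ xs f
∑-*ˡ c f []       = sym (ℕ.*-zeroʳ c)
∑-*ˡ c f (x ∷ xs) =
  trans (cong (_+_ (c * f x)) (∑-*ˡ c f xs)) (sym (ℕ.*-distribˡ-+ c (f x) _))

∑-*ʳ : ∀ (f : X → ℕ) c xs → ∑ xs (λ x → f x * c) ≡ ∑ xs f * c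
∑-*ʳ f c xs = trans (∑-cong xs λ x → ℕ.*-comm (f x) c)
  (trans (∑-*ˡ c f xs) (ℕ.*-comm c _))

∑-const : ∀ (xs : List X) c → ∑ xs (λ _ → c) ≡ length xs * c
∑-const []       c = refl
∑-const (x ∷ xs) c = cong (_+_ c) (∑-const xs c)

∑-swap : ∀ (xs : List X) (ys : List Y) (f : X → Y → ℕ) →
         ∑[ x ← xs ] ∑[ y ← ys ] f x y ≡ ∑[ y ← ys ] ∑[ x ← xs ] f x y
∑-swap []       ys f = sym (trans (∑-const ys 0) (ℕ.*-zeroʳ (length ys)))
∑-swap (x ∷ xs) ys f =
  trans (cong (_+_ (∑ ys (f x))) (∑-swap xs ys f)) (sym (∑-+ (f x) _ ys))

∑-* : ∀ (xs : List X) (ys : List Y) (f : X → ℕ) (g : Y → ℕ) →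
      ∑[ x ← xs ] ∑[ y ← ys ] f x * g y ≡ ∑ xs f * ∑ ys g
∑-* xs ys f g = trans (∑-cong xs λ x → ∑-*ˡ (f x) g ys) (∑-*ʳ f (∑ ys g) xs)

∑-++ : ∀ (f : X → ℕ) xs ys → ∑ (xs ++ ys) f ≡ ∑ xs f + ∑ ys f
∑-++ f []       ys = refl
∑-++ f (x ∷ xs) ys =
  trans (cong (_+_ (f x)) (∑-++ f xs ys)) (sym (ℕ.+-assoc (f x) _ _))

∑-map : ∀ (f : Y → ℕ) (g : X → Y) xs → ∑ (map g xs) f ≡ ∑ xs (f ∘ g)
∑-map f g []       = refl
∑-map f g (x ∷ xs) = cong (_+_ (f (g x))) (∑-map f g xs)

∑-cartesianProduct : ∀ (f : X × Y → ℕ) xs ys →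
  ∑ (cartesianProduct xs ys) f ≡ ∑[ x ← xs ] ∑[ y ← ys ] f (x , y)
∑-cartesianProduct f []       ys = refl
∑-cartesianProduct f (x ∷ xs) ys = trans (∑-++ f (map (x ,_) ys) _)
  (cong₂ _+_ (∑-map f (x ,_) ys) (∑-cartesianProduct f xs ys))

∑-extract : ∀ (f : X → ℕ) xs {x} ys → ∑ (xs ++ x ∷ ys) f ≡ f x + ∑ (xs ++ ys) f
∑-extract f []       ys = refl
∑-extract f (z ∷ xs) {x} ys = trans (cong (_+_ (f z)) (∑-extract f xs ys)) (shuffle (f z) (f x) _)
  where
  shuffle : ∀ a b c → a + (b + c) ≡ b + (a + c)
  shuffle = solve-∀

∈-drop : ∀ (xs : List X) {x y ys} → y ≢ x → y ∈ˡ xs ++ x ∷ ys → y ∈ˡ xs ++ ys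
∈-drop []       y≢x (here y≡x) = contradiction y≡x y≢x
∈-drop []       y≢x (there p)  = p
∈-drop (z ∷ xs) y≢x (here y≡z) = here y≡z
∈-drop (z ∷ xs) y≢x (there p)  = there (∈-drop xs y≢x p)

-- Each entry of `xs` uses up one occurrence in `ys`. Since `xs` has no repetitions, its remaining
-- entries survive the removal of that occurrence.
∑-⊆ : ∀ (f : X → ℕ) {xs} ys → Unique xs → (∀ {x} → x ∈ˡ xs → x ∈ˡ ys) → ∑ xs f ≤ ∑ ys f
∑-⊆ f {[]}     ys u sub = z≤n
∑-⊆ f {x ∷ xs} ys (x∉ ∷ u) sub with List.∈-∃++ (sub (here refl))
... | ys₁ , ys₂ , refl = ℕ.≤-trans
  (ℕ.+-monoʳ-≤ (f x) (∑-⊆ f (ys₁ ++ ys₂) u λ p →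
    ∈-drop ys₁ (All.lookup x∉ p ∘ sym) (sub (there p))))
  (ℕ.≤-reflexive (sym (∑-extract f ys₁ ys₂)))

-- Indicators and counting.

ι : Dec P → ℕ
ι (yes _) = 1
ι (no _)  = 0

ι≤1 : (p : Dec P) → ι p ≤ 1
ι≤1 (yes _) = ℕ.≤-refl
ι≤1 (no _)  = z≤n

ι-yes : (p : Dec P) → P → 1 ≤ ι p
ι-yes (yes _) _ = ℕ.≤-refl
ι-yes (no ¬p) x = contradiction x ¬p

ι-no : (p : Dec P) → ¬ P → ι p ≤ 0
ι-no (yes p) ¬p = contradiction p ¬p
ι-no (no _)  _  = z≤n

ι-bound : ∀ (p : Dec P) {c} → (P → 1 ≤ c) → ι p ≤ c
ι-bound (yes p) h = h p
ι-bound (no _)  h = z≤n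

ι-mono : (p : Dec P) (q : Dec Q) → (P → Q) → ι p ≤ ι q
ι-mono p q h = ι-bound p (ι-yes q ∘ h)

ι-cong : (p : Dec P) (q : Dec Q) → (P → Q) → (Q → P) → ι p ≡ ι q
ι-cong p q f g = ℕ.≤-antisym (ι-mono p q f) (ι-mono q p g)

ι-× : (p : Dec P) (q : Dec Q) → ι (p ×-dec q) ≡ ι p * ι q
ι-× (yes _) (yes _) = refl
ι-× (yes _) (no _)  = refl
ι-× (no _)  (yes _) = refl
ι-× (no _)  (no _)  = refl

ι-*-bound : ∀ (p : Dec P) {x c} → (P → x ≤ c) → ι p * x ≤ c
ι-*-bound (yes p) {x} h = ℕ.≤-trans (ℕ.≤-reflexive (ℕ.*-identityˡ x)) (h p)
ι-*-bound (no _)      h = z≤n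

∑ι≡length : ∀ {P : Pred X 0ℓ} (P? : Decidable P) xs → ∑ xs (ι ∘ P?) ≡ length (filter P? xs)
∑ι≡length P? []       = refl
∑ι≡length P? (x ∷ xs) with P? x
... | yes _ = cong suc (∑ι≡length P? xs)
... | no _  = ∑ι≡length P? xs

length-⊆ : ∀ {xs ys : List X} → Unique xs → (∀ {x} → x ∈ˡ xs → x ∈ˡ ys) → length xs ≤ length ys
length-⊆ {xs = xs} {ys} u sub = subst₂ _≤_ (∑1 xs) (∑1 ys) (∑-⊆ (λ _ → 1) ys u sub)
  where
  ∑1 : (zs : List _) → ∑ zs (λ _ → 1) ≡ length zs
  ∑1 zs = trans (∑-const zs 1) (ℕ.*-identityʳ _)

∑ι≤length : ∀ {P : Pred X 0ℓ} (P? : Decidable P) {xs} ys → Unique xs →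
            (∀ {x} → P x → x ∈ˡ ys) → ∑ xs (ι ∘ P?) ≤ length ys
∑ι≤length P? {xs} ys u sub = ℕ.≤-trans (ℕ.≤-reflexive (∑ι≡length P? xs))
  (length-⊆ (Unique.filter⁺ P? u) λ p → sub (proj₂ (List.∈-filter⁻ P? {xs = xs} p)))

∑ι≤1 : ∀ {P : Pred X 0ℓ} (P? : Decidable P) {xs} → Unique xs →
       (∀ {x y} → P x → P y → x ≡ y) → ∑ xs (ι ∘ P?) ≤ 1
∑ι≤1 P? {xs} u same with Any.any? P? xs
... | yes a = let (x , _ , px) = find a in ∑ι≤length P? (x ∷ []) u λ py → here (same py px)
... | no ¬a = ℕ.≤-trans (∑-mono-∈ xs λ m → ι-no (P? _) λ px → ¬a (lose m px))
  (ℕ.≤-trans (ℕ.≤-reflexive (trans (∑-const xs 0) (ℕ.*-zeroʳ (length xs)))) z≤n)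

∑-term : ∀ (f : X → ℕ) {x} xs → x ∈ˡ xs → f x ≤ ∑ xs f
∑-term f (x ∷ xs) (here refl) = ℕ.m≤m+n _ _
∑-term f (x ∷ xs) (there p)   = ℕ.≤-trans (∑-term f xs p) (ℕ.m≤n+m _ _)

-- Summing 2uv ≤ u² + v² over all ordered pairs of entries gives twice the inequality.
∑-cauchy : ∀ (f : X → ℕ) xs → ∑ xs f * ∑ xs f ≤ length xs * (∑[ x ← xs ] f x * f x)
∑-cauchy f xs = ℕ.*-cancelˡ-≤ 2 (begin
  2 * (∑ xs f * ∑ xs f)
    ≡⟨ cong (2 *_) (sym (∑-* xs xs f f)) ⟩
  2 * (∑[ x ← xs ] ∑[ y ← xs ] f x * f y)
    ≡⟨ sym (trans (∑-cong xs λ x → ∑-*ˡ 2 _ xs) (∑-*ˡ 2 _ xs)) ⟩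
  (∑[ x ← xs ] ∑[ y ← xs ] 2 * (f x * f y))
    ≤⟨ ∑-mono xs (λ x → ∑-mono xs λ y → amgm (f x) (f y)) ⟩
  (∑[ x ← xs ] ∑[ y ← xs ] f x * f x + f y * f y)
    ≡⟨ ∑-cong xs (λ x → trans (∑-+ _ _ xs) (cong (_+ s) (∑-const xs _))) ⟩
  (∑[ x ← xs ] length xs * (f x * f x) + s)
    ≡⟨ trans (∑-+ _ _ xs) (cong₂ _+_ (∑-*ˡ (length xs) _ xs) (∑-const xs s)) ⟩
  length xs * s + length xs * s
    ≡⟨ cong (_+_ (length xs * s)) (sym (ℕ.+-identityʳ _)) ⟩
  2 * (length xs * s) ∎)
  where
  open ℕ.≤-Reasoning
  s : ℕ
  s = ∑[ x ← xs ] f x * f x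
  -- With the larger number written as `a + d`, the difference of the two sides is d², so no
  -- subtraction occurs.
  amgm′ : ∀ a d → 2 * (a * (a + d)) ≤ a * a + (a + d) * (a + d)
  amgm′ a d = subst (2 * (a * (a + d)) ≤_) (eq a d) (ℕ.m≤m+n _ (d * d))
    where
    eq : ∀ a d → 2 * (a * (a + d)) + d * d ≡ a * a + (a + d) * (a + d)
    eq = solve-∀
  amgm : ∀ a b → 2 * (a * b) ≤ a * a + b * b
  amgm a b with ℕ.≤-total a b
  ... | inj₁ a≤b = subst (λ b → 2 * (a * b) ≤ a * a + b * b) (ℕ.m+[n∸m]≡n a≤b) (amgm′ a (b ∸ a))
  ... | inj₂ b≤a = subst₂ _≤_ (cong (2 *_) (ℕ.*-comm b a)) (ℕ.+-comm (b * b) (a * a))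
    (subst (λ a → 2 * (b * a) ≤ b * b + a * a) (ℕ.m+[n∸m]≡n b≤a) (amgm′ b (a ∸ b)))

-- Sums over the vertex set and a pigeonhole principle.

private variable
  n : ℕ

-- Opaque, so that n can be inferred from V {n}.
opaque
  V : List (Fin n)
  V = allFin _

  V-unique : Unique (V {n})
  V-unique {n} = Unique.allFin⁺ n

  ∈V : (x : Fin n) → x ∈ˡ V
  ∈V = List.∈-allFin

  length-V : length (V {n}) ≡ n
  length-V {n} = List.length-tabulate {n = n} id

opaque
  unfolding V

  ∑V-suc : (f : Fin (suc n) → ℕ) → ∑ V f ≡ f zero + ∑ V (f ∘ suc)
  ∑V-suc {n} f = cong (_+_ (f zero))
    (trans (cong (λ xs → ∑ xs f) (sym (List.map-tabulate id suc))) (∑-map f suc (allFin n)))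

∑V-const : ∀ c → ∑ (V {n}) (λ _ → c) ≡ n * c
∑V-const {n} c = trans (∑-const V c) (cong (_* c) (length-V {n}))

infix 4 _∈ˡ?_
_∈ˡ?_ : (x : Fin n) (xs : List (Fin n)) → Dec (x ∈ˡ xs)
x ∈ˡ? xs = Any.any? (x Fin.≟_) xs

count : {P : Pred (Fin n) 0ℓ} → Decidable P → ℕ
count P? = ∑ V (ι ∘ P?)

count-list≤ : {P : Pred (Fin n) 0ℓ} (P? : Decidable P) (S : List (Fin n)) →
              (∀ {x} → P x → x ∈ˡ S) → count P? ≤ length S
count-list≤ P? S sub = ∑ι≤length P? S V-unique sub

choose∉ : {P : Pred (Fin n) 0ℓ} (P? : Decidable P) (S : List (Fin n)) →
          length S < count P? → ∃[ x ] P x × x ∉ˡ S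
choose∉ {P = P} P? S lt with Fin.any? (λ x → P? x ×-dec ¬? (x ∈ˡ? S))
... | yes found = found
... | no none = contradiction (count-list≤ P? S sub) (ℕ.<⇒≱ lt)
  where
  sub : ∀ {x} → P x → x ∈ˡ S
  sub {x} px = decidable-stable (x ∈ˡ? S) λ x∉ → none (x , px , x∉)

-- If every related pair meets `S`, at most m² pairs lie inside `S`, and each of the at most `m`
-- entries of `S` has at most `t` partners outside on either side unless its row or column is long.
-- In the application `S` is the path being grown.
grid-pigeonhole : {R : Fin n → Fin n → Set} (R? : Decidable₂ R) (S : List (Fin n)) (m t : ℕ) →
       length S ≤ m → m * m + (m * t + m * t) < ∑[ c ← V ] ∑[ d ← V ] ι (R? c d) →
       (∃[ c ] ∃[ d ] R c d × c ∉ˡ S × d ∉ˡ S)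
       ⊎ (∃[ c ] t < count (λ d → R? c d ×-dec ¬? (d ∈ˡ? S)))
       ⊎ (∃[ d ] t < count (λ c → R? c d ×-dec ¬? (c ∈ˡ? S)))
grid-pigeonhole {R = R} R? S m t |S|≤m lt
  with Fin.any? (λ c → Fin.any? λ d → R? c d ×-dec (¬? (c ∈ˡ? S) ×-dec ¬? (d ∈ˡ? S)))
... | yes (c , d , h) = inj₁ (c , d , h)
... | no none with Fin.any? (λ c → t ℕ.<? count (λ d → R? c d ×-dec ¬? (d ∈ˡ? S)))
...   | yes h = inj₂ (inj₁ h)
...   | no noRow with Fin.any? (λ d → t ℕ.<? count (λ c → R? c d ×-dec ¬? (c ∈ˡ? S)))
...     | yes h = inj₂ (inj₂ h)
...     | no noCol = contradiction bound (ℕ.<⇒≱ lt)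
  where
  open ℕ.≤-Reasoning
  s : _ → ℕ
  s x = ι (x ∈ˡ? S)
  row col : _ → _ → ℕ
  row c d = ι (R? c d ×-dec ¬? (d ∈ˡ? S))
  col d c = ι (R? c d ×-dec ¬? (c ∈ˡ? S))
  s≤ : ∑ V s ≤ m
  s≤ = ℕ.≤-trans (count-list≤ (_∈ˡ? S) S id) |S|≤m
  pointwise : ∀ c d → ι (R? c d) ≤ s c * s d + (s c * row c d + s d * col d c)
  pointwise c d = ι-bound (R? c d) cases
    where
    cases : R c d → 1 ≤ s c * s d + (s c * row c d + s d * col d c)
    cases r with c ∈ˡ? S | d ∈ˡ? S | R? c d
    ... | yes _ | yes _ | _ = s≤s z≤n
    ... | yes _ | no _  | yes _ = s≤s z≤n
    ... | yes _ | no _  | no ¬r = contradiction r ¬r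
    ... | no _  | yes _ | yes _ = s≤s z≤n
    ... | no _  | yes _ | no ¬r = contradiction r ¬r
    ... | no c∉ | no d∉ | _ = contradiction (c , d , r , c∉ , d∉) none
  strip : (f : Fin _ → Fin _ → ℕ) → (∀ c → ∑ V (f c) ≤ t) →
          ∑[ c ← V ] ∑[ d ← V ] s c * f c d ≤ m * t
  strip f h = begin
    (∑[ c ← V ] ∑[ d ← V ] s c * f c d) ≡⟨ ∑-cong V (λ c → ∑-*ˡ (s c) (f c) V) ⟩
    (∑[ c ← V ] s c * ∑ V (f c))        ≤⟨ ∑-mono V (λ c → ℕ.*-monoʳ-≤ (s c) (h c)) ⟩
    (∑[ c ← V ] s c * t)                ≡⟨ ∑-*ʳ s t V ⟩
    ∑ V s * t                           ≤⟨ ℕ.*-monoˡ-≤ t s≤ ⟩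
    m * t                               ∎
  bound : ∑[ c ← V ] ∑[ d ← V ] ι (R? c d) ≤ m * m + (m * t + m * t)
  bound = begin
    (∑[ c ← V ] ∑[ d ← V ] ι (R? c d))
      ≤⟨ ∑-mono V (λ c → ∑-mono V (pointwise c)) ⟩
    (∑[ c ← V ] ∑[ d ← V ] s c * s d + (s c * row c d + s d * col d c))
      ≡⟨ ∑-cong V (λ c → trans (∑-+ _ _ V) (cong (_+_ (∑ V (λ d → s c * s d))) (∑-+ _ _ V))) ⟩
    (∑[ c ← V ] (∑[ d ← V ] s c * s d) + ((∑[ d ← V ] s c * row c d) + (∑[ d ← V ] s d * col d c)))
      ≡⟨ trans (∑-+ _ _ V) (cong (_+_ (∑[ c ← V ] ∑[ d ← V ] s c * s d)) (∑-+ _ _ V)) ⟩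
    (∑[ c ← V ] ∑[ d ← V ] s c * s d)
      + ((∑[ c ← V ] ∑[ d ← V ] s c * row c d) + (∑[ c ← V ] ∑[ d ← V ] s d * col d c))
      ≤⟨ ℕ.+-mono-≤ (ℕ.≤-trans (ℕ.≤-reflexive (∑-* V V s s)) (ℕ.*-mono-≤ s≤ s≤))
         (ℕ.+-mono-≤ (strip row λ c → ℕ.≮⇒≥ λ lt → noRow (c , lt))
           (ℕ.≤-trans (ℕ.≤-reflexive (∑-swap V V _)) (strip col λ d → ℕ.≮⇒≥ λ lt → noCol (d , lt)))) ⟩
    m * m + (m * t + m * t) ∎

-- Containment as an injective homomorphism.

Embedding : ∀ {m} → Graph m → Graph n → Set
Embedding {n} {m} H G =
  Σ[ f ∈ (Fin m → Fin n) ] Injective _≡_ _≡_ f × (∀ {i j} → Graph.Adj H i j → Graph.Adj G (f i) (f j))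

contains⇒embedding : ∀ {m} {H : Graph m} {G : Graph n} → Contains G H → Embedding H G
contains⇒embedding (S , sub , iso) =
  to , injective , λ a → _⊑_.edges sub _ _ (Equivalence.to (adjacency _ _) a)
  where open _≅_ iso

fromDec : {P : Pred (Fin n) 0ℓ} → Decidable P → Subset n
fromDec P? = tabulate λ x → does (P? x)

∈-fromDec⁺ : {P : Pred (Fin n) 0ℓ} (P? : Decidable P) {x : Fin n} → P x → x Subset.∈ fromDec P?
∈-fromDec⁺ P? {x} px =
  Vec.lookup⇒[]= x _ (trans (Vec.lookup∘tabulate _ x) (dec-true (P? x) px))

∈-fromDec⁻ : {P : Pred (Fin n) 0ℓ} (P? : Decidable P) {x : Fin n} → x Subset.∈ fromDec P? → P x
∈-fromDec⁻ P? {x} m with P? x | trans (sym (Vec.lookup∘tabulate (λ x → does (P? x)) x)) (Vec.[]=⇒lookup m)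
... | yes p | _ = p
... | no _  | ()

fromRel : {R : Fin n → Fin n → Set} → Decidable₂ R → Vec (Subset n) n
fromRel R? = tabulate λ x → fromDec (R? x)

∈-fromRel⁺ : {R : Fin n → Fin n → Set} (R? : Decidable₂ R) {x y : Fin n} →
             R x y → y Subset.∈ lookup (fromRel R?) x
∈-fromRel⁺ R? {x} {y} r =
  subst (y Subset.∈_) (sym (Vec.lookup∘tabulate (λ x → fromDec (R? x)) x)) (∈-fromDec⁺ (R? x) r)

∈-fromRel⁻ : {R : Fin n → Fin n → Set} (R? : Decidable₂ R) {x y : Fin n} →
             y Subset.∈ lookup (fromRel R?) x → R x y
∈-fromRel⁻ R? {x} {y} m =
  ∈-fromDec⁻ (R? x) (subst (y Subset.∈_) (Vec.lookup∘tabulate (λ x → fromDec (R? x)) x) m)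

embedding⇒contains : ∀ {m} {H : Graph m} {G : Graph n} → Embedding H G → Contains G H
embedding⇒contains {n} {m} {H} {G} (f , f-inj , f-adj) =
  subgraph (fromDec inImage?) (fromRel imageEdge?) , record
    { symmetric = λ u v e → let (i , j , a , p , q) = ∈-fromRel⁻ imageEdge? e
                            in ∈-fromRel⁺ imageEdge? (j , i , Graph.sym H a , q , p)
    ; endpoints = λ u v e → let (i , j , _ , p , q) = ∈-fromRel⁻ imageEdge? e
                            in ∈-fromDec⁺ inImage? (i , p) , ∈-fromDec⁺ inImage? (j , q)
    ; edges = λ u v e → let (i , j , a , p , q) = ∈-fromRel⁻ imageEdge? e
                        in subst₂ (Graph.Adj G) p q (f-adj a)
    } , record
    { to = f
    ; injective = f-inj
    ; image = λ v → mk⇔ (∈-fromDec⁻ inImage?) (∈-fromDec⁺ inImage?)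
    ; adjacency = λ i j → mk⇔
        (λ a → ∈-fromRel⁺ imageEdge? (i , j , a , refl , refl))
        (λ e → let (i′ , j′ , a , p , q) = ∈-fromRel⁻ imageEdge? e
               in subst₂ (Graph.Adj H) (f-inj p) (f-inj q) a)
    }
  where
  inImage? : Decidable λ v → ∃[ i ] f i ≡ v
  inImage? v = Fin.any? λ i → f i Fin.≟ v
  imageEdge? : Decidable₂ λ u v → ∃[ i ] ∃[ j ] Graph.Adj H i j × f i ≡ u × f j ≡ v
  imageEdge? u v = Fin.any? λ i → Fin.any? λ j →
    Graph.adj? H i j ×-dec ((f i Fin.≟ u) ×-dec (f j Fin.≟ v))

-- Paths and the cycles obtained by closing them.

lookup-injective : ∀ {xs : List X} → Unique xs → ∀ i j → lookupˡ xs i ≡ lookupˡ xs j → i ≡ j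
lookup-injective (x∉ ∷ u) zero    zero    e = refl
lookup-injective (x∉ ∷ u) zero    (suc j) e = contradiction e (All.lookup x∉ (List.∈-lookup j))
lookup-injective (x∉ ∷ u) (suc i) zero    e = contradiction (sym e) (All.lookup x∉ (List.∈-lookup i))
lookup-injective (x∉ ∷ u) (suc i) (suc j) e = cong suc (lookup-injective u i j e)

unique-∷ : ∀ {x : X} {xs} → x ∉ˡ xs → Unique xs → Unique (x ∷ xs)
unique-∷ {xs = xs} x∉ u = All.tabulate (λ { p refl → x∉ p }) ∷ u

unique-reverse : ∀ {xs : List X} → Unique xs → Unique (reverse xs)
unique-reverse {X} {xs} = Permutation.Unique-resp-↭ (setoid X)
  (Permutation.↭-sym (setoid X) (Permutation.↭-reverse (setoid X) xs))

module Paths {n} (G : Graph n) where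
  open Graph G using (Adj; adj?)

  -- Strictly a walk: that no vertex repeats is a separate `Unique` condition on the index list. The
  -- length of that list counts vertices, hence is the length of the cycle after closing.
  data Path : Fin n → Fin n → List (Fin n) → Set where
    [_] : ∀ v → Path v v (v ∷ [])
    _∷_ : ∀ {u v w xs} → Adj u v → Path v w xs → Path u w (u ∷ xs)

  path-lookup-first : ∀ {u w xs} → Path u w xs → ∀ i → toℕ i ≡ 0 → lookupˡ xs i ≡ u
  path-lookup-first [ v ]   zero e = refl
  path-lookup-first (a ∷ p) zero e = refl

  path-lookup-last : ∀ {u w xs} → Path u w xs → ∀ i → suc (toℕ i) ≡ length xs → lookupˡ xs i ≡ w
  path-lookup-last [ v ]         zero    e = refl
  path-lookup-last (a ∷ [ v ])   zero    ()
  path-lookup-last (a ∷ b ∷ p)   zero    ()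
  path-lookup-last (a ∷ p)       (suc i) e = path-lookup-last p i (ℕ.suc-injective e)

  path-lookup-suc : ∀ {u w xs} → Path u w xs → ∀ i j → suc (toℕ i) ≡ toℕ j →
                    Adj (lookupˡ xs i) (lookupˡ xs j)
  path-lookup-suc [ v ]   zero    zero    ()
  path-lookup-suc (a ∷ p) zero    (suc j) e =
    subst (Adj _) (sym (path-lookup-first p j (sym (ℕ.suc-injective e)))) a
  path-lookup-suc (a ∷ p) (suc i) (suc j) e = path-lookup-suc p i j (ℕ.suc-injective e)

  closedPath⇒cycle : ∀ {u w xs} → Path u w xs → Unique xs → Adj w u → Contains G (cycle (length xs))
  closedPath⇒cycle {u} {w} {xs} p uniq wu =
    embedding⇒contains {H = cycle (length xs)} {G} (lookupˡ xs , (λ {i} {j} → lookup-injective uniq i j) ,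
      λ { {i} {j} (_ , inj₁ s) → successive i j s ; {i} {j} (_ , inj₂ s) → Graph.sym G (successive j i s) })
    where
    successive : ∀ i j → Successive i j → Adj (lookupˡ xs i) (lookupˡ xs j)
    successive i j (inj₁ e)       = path-lookup-suc p i j e
    successive i j (inj₂ (e , z)) =
      subst₂ Adj (sym (path-lookup-last p i e)) (sym (path-lookup-first p j z)) wu

  path-∷ʳ : ∀ {u v w xs} → Path u v xs → Adj v w → Path u w (xs ++ w ∷ [])
  path-∷ʳ [ v ]   b = b ∷ [ _ ]
  path-∷ʳ (a ∷ p) b = a ∷ path-∷ʳ p b

  path-reverse : ∀ {u w xs} → Path u w xs → Path w u (reverse xs)
  path-reverse [ v ] = [ v ]
  path-reverse {u} {w} {_ ∷ xs} (a ∷ p) =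
    subst (Path w u) (sym (List.unfold-reverse u xs)) (path-∷ʳ (path-reverse p) (Graph.sym G a))

  interleave : List (Fin n) → List (Fin n) → List (Fin n)
  interleave (x ∷ xs) (y ∷ ys) = x ∷ y ∷ interleave xs ys
  interleave _        _        = []

  ∈-interleave : ∀ {v} xs ys → v ∈ˡ interleave xs ys → v ∈ˡ xs ⊎ v ∈ˡ ys
  ∈-interleave (x ∷ xs) (y ∷ ys) (here e)          = inj₁ (here e)
  ∈-interleave (x ∷ xs) (y ∷ ys) (there (here e))  = inj₂ (here e)
  ∈-interleave (x ∷ xs) (y ∷ ys) (there (there p)) = Sum.map there there (∈-interleave xs ys p)

  interleave-unique : ∀ {xs ys} → Unique xs → Unique ys → (∀ {v} → v ∈ˡ xs → v ∉ˡ ys) →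
                      Unique (interleave xs ys)
  interleave-unique {[]}     {_}      ux        uy        dis = []
  interleave-unique {x ∷ xs} {[]}     ux        uy        dis = []
  interleave-unique {x ∷ xs} {y ∷ ys} (x∉ ∷ ux) (y∉ ∷ uy) dis = unique-∷
    (λ { (here refl) → dis (here refl) (here refl)
       ; (there p) → [ (λ q → All.lookup x∉ q refl) , (λ q → dis (here refl) (there q)) ]′ (∈-interleave xs ys p) })
    (unique-∷
      (λ p → [ (λ q → dis (there q) (here refl)) , (λ q → All.lookup y∉ q refl) ]′ (∈-interleave xs ys p))
      (interleave-unique ux uy (λ p q → dis (there p) (there q))))

  interleave-length : ∀ xs ys → length xs ≡ length ys → length (interleave xs ys) ≡ 2 * length xs
  interleave-length []       []       e = refl
  interleave-length (x ∷ xs) (y ∷ ys) e = trans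
    (cong (λ l → suc (suc l)) (interleave-length xs ys (ℕ.suc-injective e))) (sym (ℕ.*-suc 2 (length xs)))

  -- Which vertex comes last does not matter, only that it lies on the side opposite to `x`, so that
  -- the closing edge is available.
  interleave-path : ∀ x xs y ys → length xs ≡ length ys →
    (∀ {u v} → u ∈ˡ x ∷ xs → v ∈ˡ y ∷ ys → Adj u v) →
    ∃[ w ] w ∈ˡ (y ∷ ys) × Path x w (interleave (x ∷ xs) (y ∷ ys))
  interleave-path x []        y []        e adj = y , here refl , adj (here refl) (here refl) ∷ [ y ]
  interleave-path x (x′ ∷ xs) y (y′ ∷ ys) e adj =
    let (w , w∈ , p) = interleave-path x′ xs y′ ys (ℕ.suc-injective e) (λ a b → adj (there a) (there b))
    in w , there w∈ , adj (here refl) (here refl) ∷ Graph.sym G (adj (there (here refl)) (here refl)) ∷ p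

  -- Both sides are cut down to exactly `k` vertices and traversed alternately; the two ends of this
  -- path lie on opposite sides and are therefore adjacent.
  biclique⇒cycle : ∀ {k xs ys} → 1 ≤ k → Unique xs → Unique ys → (∀ {v} → v ∈ˡ xs → v ∉ˡ ys) →
    k ≤ length xs → k ≤ length ys → (∀ {u v} → u ∈ˡ xs → v ∈ˡ ys → Adj u v) →
    Contains G (cycle (2 * k))
  biclique⇒cycle {k} {xs} {ys} 1≤k ux uy dis k≤xs k≤ys adj =
    build (take k xs) (take k ys) (cut xs k≤xs) (cut ys k≤ys) (Unique.take⁺ k ux) (Unique.take⁺ k uy)
      (λ p q → dis (⊆xs p) (⊆ys q)) (λ p q → adj (⊆xs p) (⊆ys q))
    where
    cut : ∀ zs → k ≤ length zs → length (take k zs) ≡ k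
    cut zs le = trans (List.length-take k zs) (ℕ.m≤n⇒m⊓n≡m le)
    ∈-take : ∀ k zs {v} → v ∈ˡ take k zs → v ∈ˡ zs
    ∈-take (suc k) (z ∷ zs) (here e)  = here e
    ∈-take (suc k) (z ∷ zs) (there p) = there (∈-take k zs p)
    ⊆xs : ∀ {v} → v ∈ˡ take k xs → v ∈ˡ xs
    ⊆xs = ∈-take k xs
    ⊆ys : ∀ {v} → v ∈ˡ take k ys → v ∈ˡ ys
    ⊆ys = ∈-take k ys
    build : ∀ xs ys → length xs ≡ k → length ys ≡ k → Unique xs → Unique ys →
            (∀ {v} → v ∈ˡ xs → v ∉ˡ ys) → (∀ {u v} → u ∈ˡ xs → v ∈ˡ ys → Adj u v) →
            Contains G (cycle (2 * k))
    build [] _ refl _ _ _ _ _ = contradiction 1≤k λ ()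
    build (x ∷ xs) [] refl ()
    build (x ∷ xs) (y ∷ ys) refl ly ux uy dis adj =
      let (w , w∈ , p) = interleave-path x xs y ys (sym (ℕ.suc-injective ly)) adj
      in subst (λ l → Contains G (cycle l)) (interleave-length (x ∷ xs) (y ∷ ys) (sym ly))
           (closedPath⇒cycle p (interleave-unique ux uy dis) (Graph.sym G (adj (here refl) w∈)))

length-filter-split : ∀ {P : Pred X 0ℓ} (P? : Decidable P) xs →
                      length xs ≡ length (filter P? xs) + length (filter (¬? ∘ P?) xs)
length-filter-split P? [] = refl
length-filter-split P? (x ∷ xs) with P? x
... | yes _ = cong suc (length-filter-split P? xs)
... | no _  = trans (cong suc (length-filter-split P? xs)) (sym (ℕ.+-suc _ _))

-- Sums over pairs and quadruples of vertices.

∑₄ : (Fin n → Fin n → Fin n → Fin n → ℕ) → ℕ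
∑₄ f = ∑[ a ← V ] ∑[ c ← V ] ∑[ b ← V ] ∑[ d ← V ] f a c b d

∑₂-mono : {f g : Fin n → Fin n → ℕ} → (∀ a b → f a b ≤ g a b) →
          ∑[ a ← V ] ∑[ b ← V ] f a b ≤ ∑[ a ← V ] ∑[ b ← V ] g a b
∑₂-mono h = ∑-mono V λ a → ∑-mono V (h a)

∑₄-mono : {f g : Fin n → Fin n → Fin n → Fin n → ℕ} → (∀ a c b d → f a c b d ≤ g a c b d) → ∑₄ f ≤ ∑₄ g
∑₄-mono h = ∑₂-mono λ a c → ∑₂-mono (h a c)

∑₂-+ : (f g : Fin n → Fin n → ℕ) → ∑[ a ← V ] ∑[ b ← V ] f a b + g a b
       ≡ (∑[ a ← V ] ∑[ b ← V ] f a b) + (∑[ a ← V ] ∑[ b ← V ] g a b)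
∑₂-+ f g = trans (∑-cong V λ a → ∑-+ (f a) (g a) V) (∑-+ _ _ V)

∑₄-+ : (f g : Fin n → Fin n → Fin n → Fin n → ℕ) → ∑₄ (λ a c b d → f a c b d + g a c b d) ≡ ∑₄ f + ∑₄ g
∑₄-+ f g = trans (∑-cong V λ a → ∑-cong V λ c → ∑₂-+ (f a c) (g a c)) (∑₂-+ _ _)

∑₄-swapˡ : (f : Fin n → Fin n → Fin n → Fin n → ℕ) → ∑₄ f ≡ ∑₄ (λ a c b d → f c a b d)
∑₄-swapˡ f = ∑-swap V V _

∑₄-swapᵐ : (f : Fin n → Fin n → Fin n → Fin n → ℕ) → ∑₄ f ≡ ∑₄ (λ a c b d → f a b c d)
∑₄-swapᵐ f = ∑-cong V λ a → ∑-swap V V _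

∑₄-swapʳ : (f : Fin n → Fin n → Fin n → Fin n → ℕ) → ∑₄ f ≡ ∑₄ (λ a c b d → f a c d b)
∑₄-swapʳ f = ∑-cong V λ a → ∑-cong V λ c → ∑-swap V V _

∑₂-const : ∀ c → ∑[ a ← V {n} ] ∑[ b ← V {n} ] c ≡ n * (n * c)
∑₂-const {n} c = trans (∑-cong V λ a → ∑V-const c) (∑V-const (n * c))

∑₂-* : ∀ x (f : Fin n → Fin n → ℕ) →
       ∑[ a ← V ] ∑[ b ← V ] f a b * x ≡ (∑[ a ← V ] ∑[ b ← V ] f a b) * x
∑₂-* x f = trans (∑-cong V λ a → ∑-*ʳ (f a) x V) (∑-*ʳ _ x V)

∑V-cauchy : (f : Fin n → ℕ) → ∑ V f * ∑ V f ≤ n * (∑[ x ← V ] f x * f x)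
∑V-cauchy f = ℕ.≤-trans (∑-cauchy f V)
  (ℕ.≤-reflexive (cong (_* (∑[ x ← V ] f x * f x)) length-V))

-- Labelled four-cycles, and the fat ones in a graph without a cycle of length 2k.

module Quads {n} (G : Graph n) where
  open Graph G using (Adj; adj?)

  common? : ∀ u v → Decidable (λ x → Adj u x × Adj v x)
  common? u v x = adj? u x ×-dec adj? v x

  codeg : Fin n → Fin n → ℕ
  codeg u v = count (common? u v)

  -- Each edge counts twice, once in each direction.
  edges : ℕ
  edges = ∑[ u ← V ] ∑[ v ← V ] ι (adj? u v)

  -- a and c are opposite vertices of the four-cycle, and so are b and d.
  Quad : (a c b d : Fin n) → Set
  Quad a c b d = a ≢ c × b ≢ d × Adj a b × Adj c b × Adj a d × Adj c d

  quad? : ∀ a c b d → Dec (Quad a c b d)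
  quad? a c b d = ¬? (a Fin.≟ c) ×-dec (¬? (b Fin.≟ d) ×-dec
    (adj? a b ×-dec (adj? c b ×-dec (adj? a d ×-dec adj? c d))))

  quads : ℕ
  quads = ∑₄ λ a c b d → ι (quad? a c b d)

  quad-sides : ∀ {a c b d} → Quad a c b d → Quad b d a c
  quad-sides (a≢c , b≢d , ab , cb , ad , cd) =
    b≢d , a≢c , Graph.sym G ab , Graph.sym G ad , Graph.sym G cb , Graph.sym G cd

  quad-swapʳ : ∀ {a c b d} → Quad a c b d → Quad a c d b
  quad-swapʳ (a≢c , b≢d , ab , cb , ad , cd) = a≢c , b≢d ∘ sym , ad , cd , ab , cb

  quad-swapˡ : ∀ {a c b d} → Quad a c b d → Quad c a b d
  quad-swapˡ = quad-sides ∘ quad-swapʳ ∘ quad-sides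

-- The bound of `grid-pigeonhole` with `m = 2 * k`, the greatest possible length of the growing
-- path, and `t = k * 2 ^ (2 * k)`, enough candidates for `homogeneous` to retain `k` of them.
threshold : ℕ → ℕ
threshold k = 2 * k * (2 * k) + (2 * k * (k * 2 ^ (2 * k)) + 2 * k * (k * 2 ^ (2 * k)))

module FatQuads {n} (G : Graph n) (k : ℕ) (1≤k : 1 ≤ k) where
  open Graph G using (Adj; adj?)
  open Paths G
  open Quads G

  -- Every `s` splits the current candidates into neighbours and non-neighbours. One class contains
  -- at least half of the guaranteed number, which pays for one factor 2.
  homogeneous : ∀ S D → k * 2 ^ length S ≤ length D → Unique D →
    ∃[ D′ ] Unique D′ × (∀ {d} → d ∈ˡ D′ → d ∈ˡ D) × k ≤ length D′ ×
      (∀ {s} → s ∈ˡ S → (∀ {d} → d ∈ˡ D′ → Adj d s) ⊎ (∀ {d} → d ∈ˡ D′ → ¬ Adj d s))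
  homogeneous []      D le u = D , u , id , subst (_≤ length D) (ℕ.*-identityʳ k) le , λ ()
  homogeneous (s ∷ S) D le u
    with k * 2 ^ length S ℕ.≤? length (filter (λ d → adj? d s) D)
  ... | yes big =
    let (D′ , u′ , sub , k≤ , hom) = homogeneous S _ big (Unique.filter⁺ (λ d → adj? d s) u)
    in D′ , u′ , proj₁ ∘ List.∈-filter⁻ (λ d → adj? d s) ∘ sub , k≤ ,
       λ { (here refl) → inj₁ (proj₂ ∘ List.∈-filter⁻ (λ d → adj? d s) {xs = D} ∘ sub) ; (there p) → hom p }
  ... | no small =
    let (D′ , u′ , sub , k≤ , hom) = homogeneous S _ big (Unique.filter⁺ (λ d → ¬? (adj? d s)) u)
    in D′ , u′ , proj₁ ∘ List.∈-filter⁻ (λ d → ¬? (adj? d s)) ∘ sub , k≤ ,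
       λ { (here refl) → inj₂ (proj₂ ∘ List.∈-filter⁻ (λ d → ¬? (adj? d s)) {xs = D} ∘ sub) ; (there p) → hom p }
    where
    twice : ∀ k x → k * (2 * x) ≡ k * x + k * x
    twice = solve-∀
    big : k * 2 ^ length S ≤ length (filter (λ d → ¬? (adj? d s)) D)
    big = ℕ.+-cancelˡ-≤ (k * 2 ^ length S) _ _ (begin
      k * 2 ^ length S + k * 2 ^ length S ≡⟨ sym (twice k _) ⟩
      k * 2 ^ length (s ∷ S)              ≤⟨ le ⟩
      length D                            ≡⟨ length-filter-split (λ d → adj? d s) D ⟩
      length (filter (λ d → adj? d s) D) + length (filter (λ d → ¬? (adj? d s)) D)
        ≤⟨ ℕ.+-monoˡ-≤ _ (ℕ.<⇒≤ (ℕ.≰⇒> small)) ⟩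
      k * 2 ^ length S + length (filter (λ d → ¬? (adj? d s)) D) ∎)
      where open ℕ.≤-Reasoning

  -- On a homogeneous `D′`, the neighbours in `S` of a single member are neighbours of all members.
  -- There are at least `k` of them, so they form a biclique with `D′`.
  trapped⇒cycle : ∀ S D → k * 2 ^ length S ≤ length D → Unique S → Unique D →
    (∀ {d} → d ∈ˡ D → d ∉ˡ S) → (∀ {d} → d ∈ˡ D → k ≤ length (filter (adj? d) S)) →
    Contains G (cycle (2 * k))
  trapped⇒cycle S D le uS uD dis deg with homogeneous S D le uD
  ... | []     , _ , _   , k≤ , _ = contradiction (ℕ.≤-trans 1≤k k≤) λ ()
  ... | D′@(d ∷ _) , u , sub , k≤ , hom = biclique⇒cycle 1≤k u (Unique.filter⁺ (adj? d) uS)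
    (λ p q → dis (sub p) (proj₁ (List.∈-filter⁻ (adj? d) q))) k≤ (deg (sub (here refl)))
    (λ p q → let (s∈ , ds) = List.∈-filter⁻ (adj? d) q
             in [ (λ all → all p) , (λ none → contradiction ds (none (here refl))) ]′ (hom s∈))

  -- The new vertices are a candidate `d` off the path and a common neighbour `x` of `b` and `d` off
  -- the path. If no such `x` exists for any `d`, fatness puts at least `k` neighbours of every
  -- candidate on the path, and the candidates are trapped.
  extend : ∀ {R : Pred (Fin n) 0ℓ} (R? : Decidable R) {b a S} → Path b a S → Unique S →
    (∀ {d} → R d → k ≤ codeg b d) →
    k * 2 ^ length S ≤ count (λ d → R? d ×-dec ¬? (d ∈ˡ? S)) →
    Contains G (cycle (2 * k)) ⊎ (∃[ d ] ∃[ x ] R d × Path d a (d ∷ x ∷ S) × Unique (d ∷ x ∷ S))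
  extend R? {b} {a} {S} p u fat many
    with Fin.any? (λ d → Fin.any? λ x → (R? d ×-dec ¬? (d ∈ˡ? S)) ×-dec (¬? (x ∈ˡ? S) ×-dec common? b d x))
  ... | yes (d , x , (r , d∉) , x∉ , bx , dx) = inj₂ (d , x , r , dx ∷ Graph.sym G bx ∷ p ,
    unique-∷ (λ { (here d≡x) → Graph.irrefl G d≡x dx ; (there q) → d∉ q }) (unique-∷ x∉ u))
  ... | no none = inj₁ (trapped⇒cycle S D (subst (_ ≤_) (∑ι≡length R′? V) many) u
    (Unique.filter⁺ R′? V-unique) (λ p → proj₂ (inD p)) λ {d} p → ℕ.≤-trans (fat (proj₁ (inD p)))
      (count-list≤ (common? b d) (filter (adj? d) S) λ {x} (bx , dx) → List.∈-filter⁺ (adj? d)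
        (decidable-stable (x ∈ˡ? S) λ x∉ → none (d , x , inD p , x∉ , bx , dx)) dx))
    where
    R′? = λ d → R? d ×-dec ¬? (d ∈ˡ? S)
    D = filter R′? V
    inD : ∀ {d} → d ∈ˡ D → _
    inD p = proj₂ (List.∈-filter⁻ R′? {xs = V} p)

  θ : ℕ
  θ = threshold k

  FatQuad : (a c b d : Fin n) → Set
  FatQuad a c b d = Quad a c b d × k ≤ codeg a c × k ≤ codeg b d

  fatQuad? : ∀ a c b d → Dec (FatQuad a c b d)
  fatQuad? a c b d = quad? a c b d ×-dec ((k ℕ.≤? codeg a c) ×-dec (k ℕ.≤? codeg b d))

  codeg-sym : ∀ u v → codeg u v ≡ codeg v u
  codeg-sym u v = ∑-cong V λ x → ι-cong (common? u v x) (common? v u x) (λ (p , q) → q , p) (λ (p , q) → q , p)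

  fatQuad-sides : ∀ {a c b d} → FatQuad a c b d → FatQuad b d a c
  fatQuad-sides (q , f , g) = quad-sides q , g , f

  fatQuad-swapʳ : ∀ {a c b d} → FatQuad a c b d → FatQuad a c d b
  fatQuad-swapʳ {b = b} {d} (q , f , g) = quad-swapʳ q , f , subst (k ≤_) (codeg-sym b d) g

  fatQuad-swapˡ : ∀ {a c b d} → FatQuad a c b d → FatQuad c a b d
  fatQuad-swapˡ = fatQuad-sides ∘ fatQuad-swapʳ ∘ fatQuad-sides

  -- `a d` and `c b` are the two edges that may take over from `a b` as closing edge, according to
  -- the end at which the path is prolonged.
  Link : (Fin n → Fin n → Set) → Fin n → Fin n → Fin n → Fin n → Set
  Link R a c b d = FatQuad a c b d × R a d × R c b

  link? : {R : Fin n → Fin n → Set} → Decidable₂ R → ∀ a c b d → Dec (Link R a c b d)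
  link? R? a c b d = fatQuad? a c b d ×-dec (R? a d ×-dec R? c b)

  linksAt : {R : Fin n → Fin n → Set} → Decidable₂ R → Fin n → Fin n → ℕ
  linksAt R? a b = ∑[ c ← V ] ∑[ d ← V ] ι (link? R? a c b d)

  -- A path closed by an edge of level j + 1 can be lengthened by two vertices
  -- so that it is closed by an edge of level j.
  mutual
    Good : ℕ → Fin n → Fin n → Set
    Good zero    a b = Adj a b
    Good (suc j) a b = Adj a b × θ < linksAt (good? j) a b

    good? : ∀ j → Decidable₂ (Good j)
    good? zero    a b = adj? a b
    good? (suc j) a b = adj? a b ×-dec (θ ℕ.<? linksAt (good? j) a b)

  -- Reading the edge backwards exchanges `c` with `d` and the two replacement edges with each
  -- other, so links at `a b` correspond to links at `b a`.
  good-sym : ∀ j {a b} → Good j a b → Good j b a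
  good-sym zero    ab        = Graph.sym G ab
  good-sym (suc j) {a} {b} (ab , lt) = Graph.sym G ab , ℕ.<-≤-trans lt
    (ℕ.≤-trans (ℕ.≤-reflexive (∑-swap V V _)) (∑₂-mono λ c d →
      ι-mono (link? (good? j) a d b c) (link? (good? j) b c a d)
        λ (f , ac , db) → fatQuad-sides f , good-sym j db , good-sym j ac))

  -- A growth trades one level for two vertices, so `length S + 2 * j` is invariant and the cycle
  -- closed at level 0 has the prescribed length.
  grow : ∀ j {a b S} → Good j a b → Path b a S → Unique S → length S + 2 * j ≡ 2 * k →
         Contains G (cycle (2 * k))
  grow zero    ab p u e = subst (λ l → Contains G (cycle l)) (trans (sym (ℕ.+-identityʳ _)) e)
    (closedPath⇒cycle p u ab)
  grow (suc j) {a} {b} {S} (_ , lt) p u e =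
    [ free , [ row , column ]′ ]′
      (grid-pigeonhole (λ c d → link? (good? j) a c b d) S (2 * k) (k * 2 ^ (2 * k)) |S|≤ lt)
    where
    |S|≤ : length S ≤ 2 * k
    |S|≤ = subst (length S ≤_) e (ℕ.m≤m+n _ _)
    shift : suc (suc (length S)) + 2 * j ≡ 2 * k
    shift = trans (eq (length S) j) e
      where
      eq : ∀ s j → suc (suc s) + 2 * j ≡ s + 2 * suc j
      eq = solve-∀
    enough : ∀ {c} → k * 2 ^ (2 * k) < c → k * 2 ^ length S ≤ c
    enough lt = ℕ.≤-trans (ℕ.*-monoʳ-≤ k (ℕ.^-monoʳ-≤ 2 |S|≤)) (ℕ.<⇒≤ lt)
    free : _ → Contains G (cycle (2 * k))
    free (c , d , (((_ , _ , _ , cb , _ , cd) , _) , ad , _) , c∉ , d∉) =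
      grow j ad (Graph.sym G cd ∷ cb ∷ p)
        (unique-∷ (λ { (here d≡c) → Graph.irrefl G (sym d≡c) cd ; (there q) → d∉ q }) (unique-∷ c∉ u)) shift
    -- Here `c` may lie on the path, but many `d` do not. `extend` goes on from `b` to one of these
    -- `d` through a substitute for `c`, and `a d` closes the path.
    row : _ → Contains G (cycle (2 * k))
    row (c , many) = [ id , (λ (d , x , (_ , ad , _) , p′ , u′) → grow j ad p′ u′ shift) ]′
      (extend (λ d → link? (good? j) a c b d) p u (λ ((_ , _ , f) , _) → f) (enough many))
    len : length (reverse S) ≡ length S
    len = List.length-reverse S
    -- The mirror image, where `d` may lie on the path: the reversed path starts at `a`, is
    -- prolonged to a new `c`, and `c b` closes it.
    column : _ → Contains G (cycle (2 * k))
    column (d , many) = [ id , (λ (c , x , (_ , _ , cb) , p′ , u′) → grow j (good-sym j cb) p′ u′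
        (trans (cong (λ l → suc (suc l) + 2 * j) len) shift)) ]′
      (extend (λ c → link? (good? j) a c b d) (path-reverse p) (unique-reverse u) (λ ((_ , f , _) , _) → f)
        (ℕ.≤-trans (ℕ.≤-reflexive (cong (λ l → k * 2 ^ l) len)) (ℕ.≤-trans (enough many)
          (∑-mono V λ c → ι-mono (link? (good? j) a c b d ×-dec ¬? (c ∈ˡ? S))
            (link? (good? j) a c b d ×-dec ¬? (c ∈ˡ? reverse S)) λ (l , c∉) → l , c∉ ∘ Any.reverse⁻))))

  links : ℕ → ℕ
  links j = ∑₄ λ a c b d → ι (link? (good? j) a c b d)

  -- A link of level `j` asks for `a d` and `c b`. If the other two sides `a b` and `c d` are good
  -- at level `j + 1`, exchanging `b` and `d` makes it a link of that level. Otherwise it is charged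
  -- to a failing side, and an edge that fails level `j + 1` carries at most `θ` links of level `j`.
  links-suc : ∀ j → links j ≤ links (suc j) + (edges * θ + edges * θ)
  links-suc j = begin
    links j
      ≤⟨ ∑₄-mono (λ a c b d → split a c b d) ⟩
    ∑₄ (λ a c b d → third a c b d + (first a c b d + first c a d b))
      ≡⟨ trans (∑₄-+ _ _) (cong (_+_ (∑₄ third)) (∑₄-+ _ _)) ⟩
    ∑₄ third + (∑₄ first + ∑₄ (λ a c b d → first c a d b))
      ≡⟨ cong₂ (λ x y → x + (∑₄ first + y)) (∑₄-swapʳ third)
           (sym (trans (∑₄-swapˡ first) (∑₄-swapʳ _))) ⟩
    ∑₄ (λ a c b d → third a c d b) + (∑₄ first + ∑₄ first)
      ≤⟨ ℕ.+-mono-≤ (∑₄-mono λ a c b d → ι-mono (third? a c d b) (link? (good? (suc j)) a c b d)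
           λ ((f , _) , ad , cb) → fatQuad-swapʳ f , ad , cb) (ℕ.+-mono-≤ first≤ first≤) ⟩
    links (suc j) + (edges * θ + edges * θ) ∎
    where
    open ℕ.≤-Reasoning
    first? : ∀ a c b d → Dec (Link (Good j) a c b d × ¬ Good (suc j) a b)
    first? a c b d = link? (good? j) a c b d ×-dec ¬? (good? (suc j) a b)
    third? : ∀ a c b d → Dec (Link (Good j) a c b d × Good (suc j) a b × Good (suc j) c d)
    third? a c b d = link? (good? j) a c b d ×-dec (good? (suc j) a b ×-dec good? (suc j) c d)
    first third : (a c b d : Fin n) → ℕ
    first a c b d = ι (first? a c b d)
    third a c b d = ι (third? a c b d)
    turn : ∀ {a c b d} → Link (Good j) a c b d → Link (Good j) c a d b
    turn (f , ad , cb) = fatQuad-swapˡ (fatQuad-swapʳ f) , cb , ad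
    split : ∀ a c b d → ι (link? (good? j) a c b d) ≤ third a c b d + (first a c b d + first c a d b)
    split a c b d = ι-bound (link? (good? j) a c b d) cases
      where
      cases : Link (Good j) a c b d → 1 ≤ third a c b d + (first a c b d + first c a d b)
      cases l = byDec (good? (suc j) a b) (good? (suc j) c d)
        where
        byDec : Dec (Good (suc j) a b) → Dec (Good (suc j) c d) →
                1 ≤ third a c b d + (first a c b d + first c a d b)
        byDec (yes g) (yes h) = ℕ.≤-trans (ι-yes (third? a c b d) (l , g , h)) (ℕ.m≤m+n _ _)
        byDec (no ¬g) _       = ℕ.≤-trans
          (ℕ.≤-trans (ι-yes (first? a c b d) (l , ¬g)) (ℕ.m≤m+n _ _)) (ℕ.m≤n+m _ (third a c b d))
        byDec (yes g) (no ¬h) = ℕ.≤-trans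
          (ℕ.≤-trans (ι-yes (first? c a d b) (turn l , ¬h)) (ℕ.m≤n+m _ (first a c b d))) (ℕ.m≤n+m _ (third a c b d))
    first≤ : ∑₄ first ≤ edges * θ
    first≤ = begin
      ∑₄ first ≡⟨ ∑₄-swapᵐ first ⟩
      (∑[ a ← V ] ∑[ b ← V ] ∑[ c ← V ] ∑[ d ← V ] first a c b d) ≤⟨ ∑₂-mono (λ a b → at a b) ⟩
      (∑[ a ← V ] ∑[ b ← V ] ι (adj? a b) * θ) ≡⟨ ∑₂-* θ _ ⟩
      edges * θ ∎
      where
      zeros : ∀ a b → (∀ c d → ¬ (Link (Good j) a c b d × ¬ Good (suc j) a b)) →
              ∑[ c ← V ] ∑[ d ← V ] first a c b d ≤ 0
      zeros a b none = ℕ.≤-trans (∑₂-mono λ c d → ι-no (first? a c b d) (none c d))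
        (ℕ.≤-reflexive (trans (∑₂-const 0) (trans (cong (n *_) (ℕ.*-zeroʳ n)) (ℕ.*-zeroʳ n))))
      at : ∀ a b → ∑[ c ← V ] ∑[ d ← V ] first a c b d ≤ ι (adj? a b) * θ
      at a b = byDec (adj? a b) (θ ℕ.<? linksAt (good? j) a b)
        where
        byDec : Dec (Adj a b) → Dec (θ < linksAt (good? j) a b) →
                ∑[ c ← V ] ∑[ d ← V ] first a c b d ≤ ι (adj? a b) * θ
        byDec (no ¬ab) _        = ℕ.≤-trans (zeros a b λ c d ((((_ , _ , ab , _) , _) , _) , _) → ¬ab ab) z≤n
        byDec (yes ab) (yes lt) = ℕ.≤-trans (zeros a b λ c d (_ , ¬g) → ¬g (ab , lt)) z≤n
        byDec (yes ab) (no ¬lt) = begin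
          (∑[ c ← V ] ∑[ d ← V ] first a c b d)
            ≤⟨ ∑₂-mono (λ c d → ι-mono (first? a c b d) (link? (good? j) a c b d) proj₁) ⟩
          linksAt (good? j) a b    ≤⟨ ℕ.≮⇒≥ ¬lt ⟩
          θ                ≡⟨ sym (ℕ.*-identityˡ θ) ⟩
          1 * θ            ≤⟨ ℕ.*-monoˡ-≤ θ (ι-yes (adj? a b) ab) ⟩
          ι (adj? a b) * θ ∎

  links-iterate : ∀ j → links 0 ≤ links j + j * (edges * θ + edges * θ)
  links-iterate zero    = ℕ.m≤m+n _ _
  links-iterate (suc j) = ℕ.≤-trans (links-iterate j) (ℕ.≤-trans
    (ℕ.+-monoˡ-≤ _ (links-suc j)) (ℕ.≤-reflexive (ℕ.+-assoc (links (suc j)) _ _)))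

  -- At level 0 every fat quadruple is a link. At level `k ∸ 1` there is none, since a good edge,
  -- taken as a path on two vertices, would grow to the forbidden cycle; so the losses of the rounds
  -- account for all of them.
  fatQuads≤ : ¬ Contains G (cycle (2 * k)) →
    ∑₄ (λ a c b d → ι (fatQuad? a c b d)) ≤ (k ∸ 1) * (edges * θ + edges * θ)
  fatQuads≤ free = begin
    ∑₄ (λ a c b d → ι (fatQuad? a c b d))
      ≤⟨ ∑₄-mono (λ a c b d → ι-mono (fatQuad? a c b d) (link? (good? 0) a c b d)
           λ { f@((_ , _ , _ , cb , ad , _) , _) → f , ad , cb }) ⟩
    links 0
      ≤⟨ links-iterate (k ∸ 1) ⟩
    links (k ∸ 1) + (k ∸ 1) * (edges * θ + edges * θ)
      ≤⟨ ℕ.+-monoˡ-≤ _ none ⟩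
    (k ∸ 1) * (edges * θ + edges * θ) ∎
    where
    open ℕ.≤-Reasoning
    ends : ∀ j {a b} → Good j a b → Adj a b
    ends zero    ab       = ab
    ends (suc j) (ab , _) = ab
    total : ∀ {k} → 1 ≤ k → 2 + 2 * (k ∸ 1) ≡ 2 * k
    total {suc k} _ = sym (ℕ.*-suc 2 k)
    noGood : ∀ a b → ¬ Good (k ∸ 1) a b
    noGood a b g = free (grow (k ∸ 1) g (Graph.sym G ab ∷ [ a ])
      (unique-∷ (λ { (here b≡a) → Graph.irrefl G (sym b≡a) ab }) ([] ∷ [])) (total 1≤k))
      where ab = ends (k ∸ 1) g
    none : links (k ∸ 1) ≤ 0
    none = ℕ.≤-trans (∑₄-mono λ a c b d → ι-no (link? (good? (k ∸ 1)) a c b d) λ (_ , ad , _) → noGood a d ad)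
      (ℕ.≤-reflexive (trans (∑-cong V λ a → ∑-cong V λ c → ∑₂-const 0)
        (trans (∑₂-const (n * (n * 0))) (zero-product n))))
      where
      zero-product : ∀ n → n * (n * (n * (n * 0))) ≡ 0
      zero-product = solve-∀

-- Thin quadruples.

pairs-count : {P : Pred (Fin n) 0ℓ} (P? : Decidable P) →
  (∑[ b ← V ] ∑[ d ← V ] ι (¬? (b Fin.≟ d) ×-dec (P? b ×-dec P? d))) + count P? ≤ count P? * count P?
pairs-count {P = P} P? = begin
  (∑[ b ← V ] ∑[ d ← V ] ι (distinct? b d)) + count P?
    ≤⟨ ℕ.+-monoʳ-≤ _ (∑-mono V diagonal) ⟩
  (∑[ b ← V ] ∑[ d ← V ] ι (distinct? b d)) + (∑[ b ← V ] ∑[ d ← V ] ι (equal? b d))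
    ≡⟨ sym (∑₂-+ _ _) ⟩
  (∑[ b ← V ] ∑[ d ← V ] ι (distinct? b d) + ι (equal? b d))
    ≤⟨ ∑₂-mono pointwise ⟩
  (∑[ b ← V ] ∑[ d ← V ] ι (P? b) * ι (P? d))
    ≡⟨ ∑-* V V _ _ ⟩
  count P? * count P? ∎
  where
  open ℕ.≤-Reasoning
  distinct? : ∀ b d → Dec (b ≢ d × P b × P d)
  distinct? b d = ¬? (b Fin.≟ d) ×-dec (P? b ×-dec P? d)
  equal? : ∀ b d → Dec (b ≡ d × P b × P d)
  equal? b d = (b Fin.≟ d) ×-dec (P? b ×-dec P? d)
  diagonal : ∀ b → ι (P? b) ≤ ∑[ d ← V ] ι (equal? b d)
  diagonal b = ℕ.≤-trans (ι-mono (P? b) (equal? b b) λ p → refl , p , p) (∑-term (ι ∘ equal? b) V (∈V b))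
  pointwise : ∀ b d → ι (distinct? b d) + ι (equal? b d) ≤ ι (P? b) * ι (P? d)
  pointwise b d with b Fin.≟ d | P? b | P? d
  ... | yes _ | yes _ | yes _ = ℕ.≤-refl
  ... | yes _ | yes _ | no _  = z≤n
  ... | yes _ | no _  | _     = z≤n
  ... | no _  | yes _ | yes _ = ℕ.≤-refl
  ... | no _  | yes _ | no _  = z≤n
  ... | no _  | no _  | _     = z≤n

pairs-count≤ : {P : Pred (Fin n) 0ℓ} (P? : Decidable P) {k : ℕ} → count P? < k →
  ∑[ b ← V ] ∑[ d ← V ] ι (¬? (b Fin.≟ d) ×-dec (P? b ×-dec P? d)) ≤ (k ∸ 1) * (k ∸ 2)
pairs-count≤ P? lt = falling _ lt (pairs-count P?)
  where
  falling : ∀ {x m} k → m < k → x + m ≤ m * m → x ≤ (k ∸ 1) * (k ∸ 2)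
  falling {x} {zero}  k             _                le =
    ℕ.≤-trans (ℕ.≤-trans (ℕ.m≤m+n x 0) le) z≤n
  falling {x} {suc m} (suc (suc k)) (s≤s (s≤s m≤k)) le = begin
    x             ≤⟨ ℕ.+-cancelʳ-≤ (suc m) x (m * suc m) (ℕ.≤-trans le (ℕ.≤-reflexive (ℕ.+-comm (suc m) _))) ⟩
    m * suc m     ≤⟨ ℕ.*-mono-≤ m≤k (s≤s m≤k) ⟩
    k * suc k     ≡⟨ ℕ.*-comm k (suc k) ⟩
    suc k * k     ∎
    where open ℕ.≤-Reasoning

module QuadBounds {n} (G : Graph n) (k : ℕ) (1≤k : 1 ≤ k) where
  open Graph G using (Adj; adj?)
  open Quads G
  open FatQuads G k 1≤k

  quads≤ : quads ≤ 2 * (n * (n * ((k ∸ 1) * (k ∸ 2)))) + ∑₄ (λ a c b d → ι (fatQuad? a c b d))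
  quads≤ = begin
    quads
      ≤⟨ ∑₄-mono split ⟩
    ∑₄ (λ a c b d → (thin a c b d + thin b d a c) + ι (fatQuad? a c b d))
      ≡⟨ trans (∑₄-+ _ _) (cong (_+ F) (∑₄-+ _ _)) ⟩
    (∑₄ thin + ∑₄ (λ a c b d → thin b d a c)) + F
      ≡⟨ cong (λ x → ∑₄ thin + x + F) (sym sides) ⟩
    (∑₄ thin + ∑₄ thin) + F
      ≡⟨ cong (λ x → ∑₄ thin + x + F) (sym (ℕ.+-identityʳ _)) ⟩
    2 * ∑₄ thin + F
      ≤⟨ ℕ.+-monoˡ-≤ F (ℕ.*-monoʳ-≤ 2 thin≤) ⟩
    2 * (n * (n * ((k ∸ 1) * (k ∸ 2)))) + F ∎
    where
    open ℕ.≤-Reasoning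
    F : ℕ
    F = ∑₄ (λ a c b d → ι (fatQuad? a c b d))
    thin? : ∀ a c b d → Dec (Quad a c b d × codeg a c < k)
    thin? a c b d = quad? a c b d ×-dec (codeg a c ℕ.<? k)
    thin : (a c b d : Fin n) → ℕ
    thin a c b d = ι (thin? a c b d)
    sides : ∑₄ thin ≡ ∑₄ (λ a c b d → thin b d a c)
    sides = trans (∑₄-swapᵐ thin) (trans (∑₄-swapˡ _) (trans (∑₄-swapʳ _) (∑₄-swapᵐ _)))
    split : ∀ a c b d → ι (quad? a c b d) ≤ (thin a c b d + thin b d a c) + ι (fatQuad? a c b d)
    split a c b d = ι-bound (quad? a c b d) λ q → cases q (codeg a c ℕ.<? k) (codeg b d ℕ.<? k)
      where
      cases : Quad a c b d → Dec (codeg a c < k) → Dec (codeg b d < k) →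
              1 ≤ (thin a c b d + thin b d a c) + ι (fatQuad? a c b d)
      cases q (yes p) _       = ℕ.≤-trans (ι-yes (thin? a c b d) (q , p))
        (ℕ.≤-trans (ℕ.m≤m+n _ _) (ℕ.m≤m+n _ _))
      cases q (no _)  (yes p) = ℕ.≤-trans (ι-yes (thin? b d a c) (quad-sides q , p))
        (ℕ.≤-trans (ℕ.m≤n+m _ (thin a c b d)) (ℕ.m≤m+n _ _))
      cases q (no p)  (no r)  = ℕ.≤-trans (ι-yes (fatQuad? a c b d) (q , ℕ.≮⇒≥ p , ℕ.≮⇒≥ r)) (ℕ.m≤n+m _ _)
    thin≤ : ∑₄ thin ≤ n * (n * ((k ∸ 1) * (k ∸ 2)))
    thin≤ = ℕ.≤-trans (∑₂-mono λ a c → at a c (codeg a c ℕ.<? k)) (ℕ.≤-reflexive (∑₂-const _))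
      where
      at : ∀ a c → Dec (codeg a c < k) → ∑[ b ← V ] ∑[ d ← V ] thin a c b d ≤ (k ∸ 1) * (k ∸ 2)
      at a c (yes lt) = ℕ.≤-trans
        (∑₂-mono λ b d → ι-mono (thin? a c b d)
          (¬? (b Fin.≟ d) ×-dec (common? a c b ×-dec common? a c d))
          λ ((_ , b≢d , ab , cb , ad , cd) , _) → b≢d , (ab , cb) , (ad , cd))
        (pairs-count≤ (common? a c) lt)
      at a c (no ¬lt) = ℕ.≤-trans (∑₂-mono λ b d → ι-no (thin? a c b d) λ (_ , lt) → ¬lt lt)
        (ℕ.≤-trans (ℕ.≤-reflexive (trans (∑₂-const 0) (zero-product n))) z≤n)
        where
        zero-product : ∀ n → n * (n * 0) ≡ 0
        zero-product = solve-∀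

-- Closed walks of length four against the number of edges.

module Walks {n} (G : Graph n) where
  open Graph G using (Adj; adj?)
  open Quads G

  -- The number of closed walks of length four: four-cycles with a labelling, degenerate ones
  -- included.
  codegs² : ℕ
  codegs² = ∑[ a ← V ] ∑[ c ← V ] codeg a c * codeg a c

  degree : Fin n → ℕ
  degree v = ∑[ u ← V ] ι (adj? u v)

  -- Both sides count walks of length two, by their middle vertex and by their ends.
  ∑degree² : ∑[ v ← V ] degree v * degree v ≡ ∑[ a ← V ] ∑[ c ← V ] codeg a c
  ∑degree² = trans (∑-cong V λ v → sym (∑-* V V _ _)) (trans (∑-swap V V _)
    (∑-cong V λ a → trans (∑-swap V V _) (∑-cong V λ c → ∑-cong V λ v → sym (ι-× (adj? a v) (adj? c v)))))

  edges≡∑degree : edges ≡ ∑ V degree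
  edges≡∑degree = ∑-swap V V _

  -- The first use of Cauchy-Schwarz is over the n degrees and leads to walks of length two; the
  -- second is over the n² ordered pairs of their ends and leads to closed walks of length four.
  edges⁴≤ : edges * edges * (edges * edges) ≤ n * n * (n * n) * codegs²
  edges⁴≤ = begin
    edges * edges * (edges * edges)  ≤⟨ ℕ.*-mono-≤ square square ⟩
    n * W * (n * W)                  ≡⟨ regroup n W ⟩
    n * n * (W * W)                  ≤⟨ ℕ.*-monoʳ-≤ (n * n) W² ⟩
    n * n * (n * (n * codegs²))      ≡⟨ regroup′ n codegs² ⟩
    n * n * (n * n) * codegs²        ∎
    where
    open ℕ.≤-Reasoning
    W : ℕ
    W = ∑[ a ← V ] ∑[ c ← V ] codeg a c
    regroup : ∀ n W → n * W * (n * W) ≡ n * n * (W * W)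
    regroup = solve-∀
    regroup′ : ∀ n x → n * n * (n * (n * x)) ≡ n * n * (n * n) * x
    regroup′ = solve-∀
    square : edges * edges ≤ n * W
    square = subst₂ _≤_ (sym (cong₂ _*_ edges≡∑degree edges≡∑degree)) (cong (n *_) ∑degree²) (∑V-cauchy degree)
    W² : W * W ≤ n * (n * codegs²)
    W² = ℕ.≤-trans (∑V-cauchy _) (ℕ.*-monoʳ-≤ n (ℕ.≤-trans (∑-mono V λ a → ∑V-cauchy (codeg a))
      (ℕ.≤-reflexive (∑-*ˡ n _ V))))

  codegs²≤ : codegs² ≤ quads + (n * (n * n) + n * (n * n))
  codegs²≤ = begin
    codegs²
      ≡⟨ ∑-cong V (λ a → ∑-cong V λ c → sym (∑-* V V _ _)) ⟩
    ∑₄ (λ a c b d → ι (common? a c b) * ι (common? a c d))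
      ≤⟨ ∑₄-mono split ⟩
    ∑₄ (λ a c b d → ι (quad? a c b d) + (ι (a Fin.≟ c) + ι (b Fin.≟ d)))
      ≡⟨ trans (∑₄-+ _ _) (cong (_+_ quads) (∑₄-+ _ _)) ⟩
    quads + (∑₄ (λ a c b d → ι (a Fin.≟ c)) + ∑₄ (λ a c b d → ι (b Fin.≟ d)))
      ≤⟨ ℕ.+-monoʳ-≤ quads (ℕ.+-mono-≤ left right) ⟩
    quads + (n * (n * n) + n * (n * n)) ∎
    where
    open ℕ.≤-Reasoning
    diagonal : ∑[ a ← V {n} ] ∑[ c ← V {n} ] ι (a Fin.≟ c) ≤ n
    diagonal = ℕ.≤-trans (∑-mono V λ a → ∑ι≤1 (a Fin.≟_) V-unique λ p q → trans (sym p) q)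
      (ℕ.≤-reflexive (trans (∑V-const 1) (ℕ.*-identityʳ n)))
    right : ∑₄ {n} (λ a c b d → ι (b Fin.≟ d)) ≤ n * (n * n)
    right = ℕ.≤-trans (∑₂-mono λ a c → diagonal) (ℕ.≤-reflexive (∑₂-const n))
    left : ∑₄ {n} (λ a c b d → ι (a Fin.≟ c)) ≤ n * (n * n)
    left = begin
      ∑₄ {n} (λ a c b d → ι (a Fin.≟ c))
        ≡⟨ ∑-cong V (λ a → ∑-cong V λ c → trans (∑₂-const (ι (a Fin.≟ c))) (regroup n _)) ⟩
      (∑[ a ← V {n} ] ∑[ c ← V {n} ] ι (a Fin.≟ c) * (n * n)) ≡⟨ ∑₂-* (n * n) _ ⟩
      (∑[ a ← V {n} ] ∑[ c ← V {n} ] ι (a Fin.≟ c)) * (n * n) ≤⟨ ℕ.*-monoˡ-≤ (n * n) diagonal ⟩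
      n * (n * n) ∎
      where
      regroup : ∀ n x → n * (n * x) ≡ x * (n * n)
      regroup = solve-∀
    split : ∀ a c b d → ι (common? a c b) * ι (common? a c d) ≤ ι (quad? a c b d) + (ι (a Fin.≟ c) + ι (b Fin.≟ d))
    split a c b d = ι-*-bound (common? a c b) λ (ab , cb) → ι-bound (common? a c d) λ (ad , cd) →
      cases ab cb ad cd (a Fin.≟ c) (b Fin.≟ d)
      where
      cases : Adj a b → Adj c b → Adj a d → Adj c d → (p : Dec (a ≡ c)) (q : Dec (b ≡ d)) →
              1 ≤ ι (quad? a c b d) + (ι p + ι q)
      cases ab cb ad cd (yes _) _       = ℕ.≤-trans (ℕ.m≤m+n 1 _) (ℕ.m≤n+m _ (ι (quad? a c b d)))
      cases ab cb ad cd (no _)  (yes _) = ℕ.m≤n+m 1 (ι (quad? a c b d))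
      cases ab cb ad cd (no p)  (no q)  = ℕ.≤-trans (ι-yes (quad? a c b d) (p , q , ab , cb , ad , cd)) (ℕ.m≤m+n _ _)

-- Triangles, edges and quadruples in a graph without a cycle of given length.

module Triangles {n} (G : Graph n) where
  open Graph G using (Adj; adj?)
  open Paths G
  open Quads G

  Triangle : Fin n → Fin n → Fin n → Set
  Triangle v u w = Adj v u × Adj v w × Adj u w

  triangle? : ∀ v u w → Dec (Triangle v u w)
  triangle? v u w = adj? v u ×-dec (adj? v w ×-dec adj? u w)

  triangles : ℕ
  triangles = ∑[ v ← V ] ∑[ u ← V ] ∑[ w ← V ] ι (triangle? v u w)

  module Link (v : Fin n) (a : ℕ) where

    -- An edge of level j starts paths on j + 2 vertices in the neighbourhood
    -- of v, chosen greedily.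
    mutual
      Good : ℕ → Fin n → Fin n → Set
      Good zero    u w = Triangle v u w
      Good (suc j) u w = Triangle v u w × a ≤ count (good? j w)

      good? : ∀ j → Decidable₂ (Good j)
      good? zero    u w = triangle? v u w
      good? (suc j) u w = triangle? v u w ×-dec (a ℕ.≤? count (good? j w))

    triangle : ∀ j {u w} → Good j u w → Triangle v u w
    triangle zero    t       = t
    triangle (suc j) (t , _) = t

    -- A vertex with `a` continuations always has one off the path, which has fewer than `a`
    -- vertices. Since the path stays among the neighbours of `v`, in the end `v` joins its two ends
    -- and supplies the last vertex of the cycle.
    grow : ∀ j {u w z S} → Good j u w → Path w z S → Unique S → (∀ {x} → x ∈ˡ S → Adj v x) → Adj z v →
           suc (length S + j) ≡ a → Contains G (cycle a)
    grow zero    {S = S} g p u nbr zv e = subst (λ l → Contains G (cycle l))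
      (trans (cong suc (sym (ℕ.+-identityʳ (length S)))) e)
      (closedPath⇒cycle (proj₁ (proj₂ (triangle 0 g)) ∷ p)
        (unique-∷ (λ v∈ → Graph.irrefl G refl (nbr v∈)) u) zv)
    grow (suc j) {w = w} {S = S} (_ , many) p u nbr zv e
      with choose∉ (good? j w) S (ℕ.≤-trans (subst (suc (length S) ≤_) e (s≤s (ℕ.m≤m+n _ _))) many)
    ... | x , g , x∉ = let (_ , vx , wx) = triangle j g in
      grow j g (Graph.sym G wx ∷ p) (unique-∷ x∉ u) (λ { (here refl) → vx ; (there q) → nbr q }) zv
        (trans (cong suc (sym (ℕ.+-suc (length S) j))) e)

    total : ℕ → ℕ
    total j = ∑[ u ← V ] ∑[ w ← V ] ι (good? j u w)

    -- A vertex `u` with fewer than `a` continuations costs at most `a` pairs. If `u` has enough of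
    -- them, each pair `u x` survives as `x u`, which then enters `u`; the reversal is harmless
    -- because all ordered pairs are summed.
    total-suc : ∀ j → total j ≤ n * a + total (suc j)
    total-suc j = begin
      total j                                              ≤⟨ ∑-mono V (λ u → row u (a ℕ.≤? count (good? j u))) ⟩
      (∑[ u ← V ] a + (∑[ x ← V ] ι (good? (suc j) x u)))  ≡⟨ ∑-+ _ _ V ⟩
      ∑ V (λ _ → a) + (∑[ u ← V ] ∑[ x ← V ] ι (good? (suc j) x u)) ≡⟨ cong₂ _+_ (∑V-const a) (∑-swap V V _) ⟩
      n * a + total (suc j)                                ∎
      where
      open ℕ.≤-Reasoning
      row : ∀ u → Dec (a ≤ count (good? j u)) → count (good? j u) ≤ a + (∑[ x ← V ] ι (good? (suc j) x u))
      row u (no ¬rich) = ℕ.≤-trans (ℕ.<⇒≤ (ℕ.≰⇒> ¬rich)) (ℕ.m≤m+n a _)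
      row u (yes rich) = ℕ.≤-trans (∑-mono V λ x → ι-mono (good? j u x) (good? (suc j) x u) λ g →
        let (vu , vx , ux) = triangle j g in (vx , vu , Graph.sym G ux) , rich) (ℕ.m≤n+m _ a)

    total-iterate : ∀ j → total 0 ≤ j * (n * a) + total j
    total-iterate zero    = ℕ.≤-refl
    total-iterate (suc j) = ℕ.≤-trans (total-iterate j) (ℕ.≤-trans (ℕ.+-monoʳ-≤ (j * (n * a)) (total-suc j))
      (ℕ.≤-reflexive (shuffle (j * (n * a)) (n * a) _)))
      where
      shuffle : ∀ x y z → x + (y + z) ≡ y + x + z
      shuffle = solve-∀

    -- The initial path `w u` and the apex `v` take three of the `a` vertices, which leaves `a ∸ 3`
    -- growths.
    total≤ : 3 ≤ a → ¬ Contains G (cycle a) → total 0 ≤ a * (n * a)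
    total≤ 3≤a free = begin
      total 0                              ≤⟨ total-iterate (a ∸ 3) ⟩
      (a ∸ 3) * (n * a) + total (a ∸ 3)    ≤⟨ ℕ.+-mono-≤ (ℕ.*-monoˡ-≤ (n * a) (ℕ.m∸n≤m a 3)) none ⟩
      a * (n * a) + 0                      ≡⟨ ℕ.+-identityʳ _ ⟩
      a * (n * a)                          ∎
      where
      open ℕ.≤-Reasoning
      noGood : ∀ u w → ¬ Good (a ∸ 3) u w
      noGood u w g = let (vu , vw , uw) = triangle (a ∸ 3) g in
        free (grow (a ∸ 3) g (Graph.sym G uw ∷ [ u ])
          (unique-∷ (λ { (here w≡u) → Graph.irrefl G (sym w≡u) uw }) ([] ∷ []))
          (λ { (here refl) → vw ; (there (here refl)) → vu }) (Graph.sym G vu) (ℕ.m+[n∸m]≡n 3≤a))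
      none : total (a ∸ 3) ≤ 0
      none = ℕ.≤-trans (∑₂-mono λ u w → ι-no (good? (a ∸ 3) u w) (noGood u w))
        (ℕ.≤-reflexive (trans (∑₂-const 0) (zero-product n)))
        where
        zero-product : ∀ n → n * (n * 0) ≡ 0
        zero-product = solve-∀

  triangles≤ : ∀ {a} → 3 ≤ a → ¬ Contains G (cycle a) → triangles ≤ n * (a * (n * a))
  triangles≤ {a} 3≤a free = ℕ.≤-trans (∑-mono V λ v → Link.total≤ v a 3≤a free) (ℕ.≤-reflexive (∑V-const _))

  -- An edge u w sees deg u + deg w ≤ n + codeg u w vertices, and
  -- the sum of deg u + deg w over the edges is twice the sum of the squared degrees.
  goodman : 2 * (edges * edges) ≤ n * (edges * n + triangles)
  goodman = begin
    2 * (edges * edges)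
      ≤⟨ ℕ.*-monoʳ-≤ 2 (∑V-cauchy degree) ⟩
    2 * (n * D)
      ≡⟨ regroup n D ⟩
    n * (D + D)
      ≡⟨ cong (n *_) (cong₂ _+_ (∑-cong V λ u → sym (∑-*ʳ _ (degree u) V))
           (trans (∑-cong V λ w → trans (cong (_* degree w) (degree-sym w)) (sym (∑-*ʳ _ (degree w) V))) (∑-swap V V _))) ⟩
    n * ((∑[ u ← V ] ∑[ w ← V ] ι (adj? u w) * degree u) + (∑[ u ← V ] ∑[ w ← V ] ι (adj? u w) * degree w))
      ≡⟨ cong (n *_) (sym (∑₂-+ _ _)) ⟩
    n * (∑[ u ← V ] ∑[ w ← V ] ι (adj? u w) * degree u + ι (adj? u w) * degree w)
      ≤⟨ ℕ.*-monoʳ-≤ n (∑₂-mono edge) ⟩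
    n * (∑[ u ← V ] ∑[ w ← V ] ι (adj? u w) * n + ι (adj? u w) * codeg u w)
      ≡⟨ cong (n *_) (trans (∑₂-+ _ _) (cong₂ _+_ (∑₂-* n _) (∑-cong V λ u → ∑-cong V λ w →
           trans (sym (∑-*ˡ (ι (adj? u w)) _ V)) (∑-cong V λ x → sym (ι-× (adj? u w) (common? u w x)))))) ⟩
    n * (edges * n + triangles) ∎
    where
    open ℕ.≤-Reasoning
    degree : Fin n → ℕ
    degree u = count (adj? u)
    D : ℕ
    D = ∑[ u ← V ] degree u * degree u
    regroup : ∀ n D → 2 * (n * D) ≡ n * (D + D)
    regroup = solve-∀
    degree-sym : ∀ w → degree w ≡ ∑[ u ← V ] ι (adj? u w)
    degree-sym w = ∑-cong V λ u → ι-cong (adj? w u) (adj? u w) (Graph.sym G) (Graph.sym G)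
    sees : ∀ u w → degree u + degree w ≤ n + codeg u w
    sees u w = begin
      degree u + degree w                            ≡⟨ sym (∑-+ _ _ V) ⟩
      (∑[ x ← V ] ι (adj? u x) + ι (adj? w x))       ≤⟨ ∑-mono V at ⟩
      (∑[ x ← V ] 1 + ι (common? u w x))             ≡⟨ ∑-+ _ _ V ⟩
      ∑ V (λ _ → 1) + codeg u w                      ≡⟨ cong (_+ codeg u w) (trans (∑V-const 1) (ℕ.*-identityʳ n)) ⟩
      n + codeg u w                                  ∎
      where
      at : ∀ x → ι (adj? u x) + ι (adj? w x) ≤ 1 + ι (common? u w x)
      at x with adj? u x | adj? w x
      ... | yes _ | yes _ = ℕ.≤-refl
      ... | yes _ | no _  = ℕ.≤-refl
      ... | no _  | yes _ = ℕ.≤-refl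
      ... | no _  | no _  = z≤n
    edge : ∀ u w → ι (adj? u w) * degree u + ι (adj? u w) * degree w ≤ ι (adj? u w) * n + ι (adj? u w) * codeg u w
    edge u w = subst₂ _≤_ (ℕ.*-distribˡ-+ (ι (adj? u w)) _ _) (ℕ.*-distribˡ-+ (ι (adj? u w)) _ _)
      (ℕ.*-monoʳ-≤ (ι (adj? u w)) (sees u w))

  -- Of the two ways of closing a pair of edges a b, c d to a four-cycle,
  -- only one is available unless a, b, c, d span a complete graph.
  quads≤edges² : 2 * quads ≤ edges * edges + n * triangles
  quads≤edges² = begin
    2 * quads
      ≡⟨ cong (_+_ quads) (ℕ.+-identityʳ quads) ⟩
    quads + quads
      ≡⟨ cong (_+_ quads) (trans (∑₄-swapᵐ _) (trans (∑₄-swapʳ _) (∑₄-swapᵐ _))) ⟩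
    quads + ∑₄ (λ a c b d → ι (quad? a d b c))
      ≡⟨ sym (∑₄-+ _ _) ⟩
    ∑₄ (λ a c b d → ι (quad? a c b d) + ι (quad? a d b c))
      ≤⟨ ∑₄-mono closing ⟩
    ∑₄ (λ a c b d → ι (adj? a b) * ι (adj? c d) + ι (triangle? a c b))
      ≡⟨ ∑₄-+ _ _ ⟩
    ∑₄ (λ a c b d → ι (adj? a b) * ι (adj? c d)) + ∑₄ (λ a c b d → ι (triangle? a c b))
      ≡⟨ cong₂ _+_ square extra ⟩
    edges * edges + n * triangles ∎
    where
    open ℕ.≤-Reasoning
    closing : ∀ a c b d → ι (quad? a c b d) + ι (quad? a d b c) ≤ ι (adj? a b) * ι (adj? c d) + ι (triangle? a c b)
    closing a c b d = cases (quad? a c b d) (quad? a d b c)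
      where
      both : Adj a b → Adj c d → 1 ≤ ι (adj? a b) * ι (adj? c d)
      both ab cd = ℕ.*-mono-≤ (ι-yes (adj? a b) ab) (ι-yes (adj? c d) cd)
      cases : (p : Dec (Quad a c b d)) (q : Dec (Quad a d b c)) →
              ι p + ι q ≤ ι (adj? a b) * ι (adj? c d) + ι (triangle? a c b)
      cases (yes (_ , _ , ab , cb , ad , cd)) (yes (_ , _ , _ , db , ac , dc)) =
        ℕ.+-mono-≤ (both ab cd) (ι-yes (triangle? a c b) (ac , ab , cb))
      cases (yes (_ , _ , ab , cb , ad , cd)) (no _) = ℕ.≤-trans (both ab cd) (ℕ.m≤m+n _ _)
      cases (no _) (yes (_ , _ , ab , db , ac , dc)) = ℕ.≤-trans (both ab (Graph.sym G dc)) (ℕ.m≤m+n _ _)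
      cases (no _) (no _) = z≤n
    square : ∑₄ (λ a c b d → ι (adj? a b) * ι (adj? c d)) ≡ edges * edges
    square = trans (∑₄-swapᵐ _) (trans
      (∑-cong V λ a → ∑-cong V λ b → trans (∑-cong V λ c → ∑-*ˡ (ι (adj? a b)) _ V) (∑-*ˡ (ι (adj? a b)) _ V))
      (∑₂-* edges _))
    extra : ∑₄ (λ a c b d → ι (triangle? a c b)) ≡ n * triangles
    extra = trans (∑-cong V λ a → trans (∑-cong V λ c → trans (∑-cong V λ b → ∑V-const _) (∑-*ˡ n _ V)) (∑-*ˡ n _ V))
      (∑-*ˡ n _ V)

-- Copies of the four-cycle and their labellings.

fromDec-≡ : {P : Pred (Fin n) 0ℓ} (P? : Decidable P) (p : Subset n) →
            (∀ v → v Subset.∈ p ⇔ P v) → p ≡ fromDec P?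
fromDec-≡ P? p h = Subset.⊆-antisym
  (λ v∈ → ∈-fromDec⁺ P? (Equivalence.to (h _) v∈)) (λ v∈ → Equivalence.from (h _) (∈-fromDec⁻ P? v∈))

-- Vertex set and rows are Boolean vectors, so pointwise agreement is equality. This identifies an
-- arbitrary copy with an explicit `fourCycle`.
subgraph-≡ : {P : Pred (Fin n) 0ℓ} (P? : Decidable P) {R : Fin n → Fin n → Set} (R? : Decidable₂ R)
  (S : Subgraph n) → (∀ v → v Subset.∈ Subgraph.vertices S ⇔ P v) → (∀ u v → Subgraph.Edge S u v ⇔ R u v) →
  S ≡ subgraph (fromDec P?) (fromRel R?)
subgraph-≡ P? R? S h e = cong₂ subgraph (fromDec-≡ P? _ h)
  (trans (sym (Vec.tabulate∘lookup _)) (Vec.tabulate-cong λ u → fromDec-≡ (R? u) _ (e u)))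

subgraph-≟ : (S T : Subgraph n) → Dec (S ≡ T)
subgraph-≟ (subgraph p r) (subgraph q t) = map′ (λ (e , f) → cong₂ subgraph e f) (λ { refl → refl , refl })
  (subset-≟ p q ×-dec Vec.≡-dec subset-≟ r t)
  where
  subset-≟ : ∀ {m} → Decidable₂ {A = Subset m} _≡_
  subset-≟ = Vec.≡-dec Bool._≟_

Among : X → X → X → Set
Among x y z = z ≡ x ⊎ z ≡ y

among? : (x y z : Fin n) → Dec (Among x y z)
among? x y z = (z Fin.≟ x) ⊎-dec (z Fin.≟ y)

-- Adjacency in the four-cycle with diagonals `a c` and `b d`, seen as the complete bipartite graph
-- between the two diagonals. This form shows the eight symmetries as swaps of disjuncts.
Across : (a c b d u v : X) → Set
Across a c b d u v = (Among a c u × Among b d v) ⊎ (Among b d u × Among a c v)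

across? : (a c b d u v : Fin n) → Dec (Across a c b d u v)
across? a c b d u v = (among? a c u ×-dec among? b d v) ⊎-dec (among? b d u ×-dec among? a c v)

corner? : (a c b d v : Fin n) → Dec (Among a c v ⊎ Among b d v)
corner? a c b d v = among? a c v ⊎-dec among? b d v

fourCycle : (a c b d : Fin n) → Subgraph n
fourCycle a c b d = subgraph (fromDec (corner? a c b d)) (fromRel (across? a c b d))

i₀ i₁ i₂ i₃ : Fin 4
i₀ = zero
i₁ = suc zero
i₂ = suc (suc zero)
i₃ = suc (suc (suc zero))

-- Decided by evaluation on the sixteen pairs of vertices.
cycle₄-adj : ∀ i j → Graph.Adj (cycle 4) i j → Across i₀ i₂ i₁ i₃ i j
cycle₄-adj = from-yes (Fin.all? λ i → Fin.all? λ j → Graph.adj? (cycle 4) i j →-dec across? i₀ i₂ i₁ i₃ i j)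

adj-cycle₄ : ∀ i j → Across i₀ i₂ i₁ i₃ i j → Graph.Adj (cycle 4) i j
adj-cycle₄ = from-yes (Fin.all? λ i → Fin.all? λ j → across? i₀ i₂ i₁ i₃ i j →-dec Graph.adj? (cycle 4) i j)

among-map : ∀ {x y z : X} (f : X → Y) → Among x y z → Among (f x) (f y) (f z)
among-map f = Sum.map (cong f) (cong f)

across-map : ∀ {a c b d u v : X} (f : X → Y) → Across a c b d u v → Across (f a) (f c) (f b) (f d) (f u) (f v)
across-map f = Sum.map (λ (p , q) → among-map f p , among-map f q) (λ (p , q) → among-map f p , among-map f q)

across-map⁻ : ∀ {a c b d u v : X} {f : X → Y} → Injective _≡_ _≡_ f →
              Across (f a) (f c) (f b) (f d) (f u) (f v) → Across a c b d u v
across-map⁻ inj = Sum.map (λ (p , q) → back p , back q) (λ (p , q) → back p , back q)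
  where
  back : ∀ {x y z} → _ → Among x y z
  back = Sum.map inj inj

fourCycle-cong : ∀ {a c b d a′ c′ b′ d′ : Fin n} →
  (∀ v → (Among a c v ⊎ Among b d v) ⇔ (Among a′ c′ v ⊎ Among b′ d′ v)) →
  (∀ u v → Across a c b d u v ⇔ Across a′ c′ b′ d′ u v) → fourCycle a c b d ≡ fourCycle a′ c′ b′ d′
fourCycle-cong {a = a} {c} {b} {d} {a′} {c′} {b′} {d′} h e =
  subgraph-≡ (corner? a′ c′ b′ d′) (across? a′ c′ b′ d′) (fourCycle a c b d)
  (λ v → mk⇔ (λ v∈ → Equivalence.to (h v) (∈-fromDec⁻ (corner? a c b d) v∈))
             (λ p → ∈-fromDec⁺ (corner? a c b d) (Equivalence.from (h v) p)))
  (λ u v → mk⇔ (λ v∈ → Equivalence.to (e u v) (∈-fromRel⁻ (across? a c b d) v∈))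
               (λ p → ∈-fromRel⁺ (across? a c b d) (Equivalence.from (e u v) p)))

fourCycle-sides : (a c b d : Fin n) → fourCycle a c b d ≡ fourCycle b d a c
fourCycle-sides a c b d = fourCycle-cong (λ v → mk⇔ Sum.swap Sum.swap) (λ u v → mk⇔ Sum.swap Sum.swap)

fourCycle-swapʳ : (a c b d : Fin n) → fourCycle a c b d ≡ fourCycle a c d b
fourCycle-swapʳ a c b d = fourCycle-cong (λ v → mk⇔ (Sum.map id Sum.swap) (Sum.map id Sum.swap))
  (λ u v → mk⇔ turn turn)
  where
  turn : ∀ {b d u v} → Across a c b d u v → Across a c d b u v
  turn = Sum.map (λ (p , q) → p , Sum.swap q) (λ (p , q) → Sum.swap p , q)

fourCycle-swapˡ : (a c b d : Fin n) → fourCycle a c b d ≡ fourCycle c a b d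
fourCycle-swapˡ a c b d = trans (fourCycle-sides a c b d)
  (trans (fourCycle-swapʳ b d a c) (fourCycle-sides b d c a))

∑-∑₄-swap : (xs : List X) (f : X → Fin n → Fin n → Fin n → Fin n → ℕ) →
            ∑[ x ← xs ] ∑₄ (f x) ≡ ∑₄ (λ a c b d → ∑[ x ← xs ] f x a c b d)
∑-∑₄-swap xs f = trans (∑-swap xs V _) (∑-cong V λ a → trans (∑-swap xs V _) (∑-cong V λ c →
  trans (∑-swap xs V _) (∑-cong V λ b → ∑-swap xs V _)))

module Copies {n} (G : Graph n) where
  open Graph G using (Adj; adj?)
  open Quads G

  fourCycleCopy? : Decidable (IsCopy (cycle 4) G)
  fourCycleCopy? = isCopy? (cycle 4) G

  copies≡∑ : copies (cycle 4) G ≡ ∑[ S ← allSubgraphs n ] ι (fourCycleCopy? S)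
  copies≡∑ = sym (∑ι≡length fourCycleCopy? (allSubgraphs n))

  copy⇒quad : ∀ S → IsCopy (cycle 4) G S →
              ∃[ a ] ∃[ c ] ∃[ b ] ∃[ d ] Quad a c b d × S ≡ fourCycle a c b d
  copy⇒quad S (sub , iso) = to i₀ , to i₂ , to i₁ , to i₃ ,
    ((λ e → contradiction (injective {i₀} {i₂} e) λ ()) , (λ e → contradiction (injective {i₁} {i₃} e) λ ()) ,
      adj i₀ i₁ (inj₁ (inj₁ refl , inj₁ refl)) , adj i₂ i₁ (inj₁ (inj₂ refl , inj₁ refl)) ,
      adj i₀ i₃ (inj₁ (inj₁ refl , inj₂ refl)) , adj i₂ i₃ (inj₁ (inj₂ refl , inj₂ refl))) ,
    subgraph-≡ (corner? _ _ _ _) (across? _ _ _ _) S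
      (λ v → mk⇔ (λ v∈ → corner (Equivalence.to (image v) v∈)) (λ c → Equivalence.from (image v) (preimage c)))
      (λ u v → mk⇔ (edge⇒ u v) (edge⇐ u v))
    where
    open _≅_ iso
    open _⊑_ sub using (endpoints) renaming (edges to edge)
    Corner : Fin n → Set
    Corner v = Among (to i₀) (to i₂) v ⊎ Among (to i₁) (to i₃) v
    adj : ∀ i j → Across i₀ i₂ i₁ i₃ i j → Adj (to i) (to j)
    adj i j h = edge _ _ (Equivalence.to (adjacency i j) (adj-cycle₄ i j h))
    corner : ∀ {v} → ∃[ i ] to i ≡ v → Corner v
    corner (zero , e) = inj₁ (inj₁ (sym e))
    corner (suc zero , e) = inj₂ (inj₁ (sym e))
    corner (suc (suc zero) , e) = inj₁ (inj₂ (sym e))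
    corner (suc (suc (suc zero)) , e) = inj₂ (inj₂ (sym e))
    preimage : ∀ {v} → Corner v → ∃[ i ] to i ≡ v
    preimage (inj₁ (inj₁ e)) = i₀ , sym e
    preimage (inj₁ (inj₂ e)) = i₂ , sym e
    preimage (inj₂ (inj₁ e)) = i₁ , sym e
    preimage (inj₂ (inj₂ e)) = i₃ , sym e
    edge⇒ : ∀ u v → Subgraph.Edge S u v → Across (to i₀) (to i₂) (to i₁) (to i₃) u v
    edge⇒ u v e with endpoints u v e
    ... | u∈ , v∈ with Equivalence.to (image u) u∈ | Equivalence.to (image v) v∈
    ...   | i , refl | j , refl = across-map to (cycle₄-adj i j (Equivalence.from (adjacency i j) e))
    edge⇐ : ∀ u v → Across (to i₀) (to i₂) (to i₁) (to i₃) u v → Subgraph.Edge S u v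
    edge⇐ u v h with preimage (source h) | preimage (target h)
      where
      source : Across (to i₀) (to i₂) (to i₁) (to i₃) u v → Corner u
      source = Sum.map proj₁ proj₁
      target : Across (to i₀) (to i₂) (to i₁) (to i₃) u v → Corner v
      target (inj₁ (_ , q)) = inj₂ q
      target (inj₂ (_ , q)) = inj₁ q
    ... | i , refl | j , refl = Equivalence.to (adjacency i j) (adj-cycle₄ i j (across-map⁻ injective h))

  quad-unique : ∀ {a c b d} → Quad a c b d → Unique (a ∷ b ∷ c ∷ d ∷ [])
  quad-unique (a≢c , b≢d , ab , cb , ad , cd) =
    ((λ e → Graph.irrefl G e ab) ∷ a≢c ∷ (λ e → Graph.irrefl G e ad) ∷ []) ∷
    ((λ e → Graph.irrefl G (sym e) cb) ∷ b≢d ∷ []) ∷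
    ((λ e → Graph.irrefl G e cd) ∷ []) ∷ [] ∷ []

  quad⇒copy : ∀ {a c b d} → Quad a c b d → IsCopy (cycle 4) G (fourCycle a c b d)
  quad⇒copy {a} {c} {b} {d} q@(_ , _ , ab , cb , ad , cd) = record
    { symmetric = λ u v e → ∈-fromRel⁺ R? (flipped (∈-fromRel⁻ R? e))
    ; endpoints = λ u v e → ∈-fromDec⁺ P? (source (∈-fromRel⁻ R? e)) , ∈-fromDec⁺ P? (source (flipped (∈-fromRel⁻ R? e)))
    ; edges = λ u v e → adj (∈-fromRel⁻ R? e)
    } , record
    { to = f
    ; injective = inj
    ; image = λ v → mk⇔ (λ v∈ → preimage (∈-fromDec⁻ P? v∈)) (λ p → ∈-fromDec⁺ P? (corner p))
    ; adjacency = λ i j → mk⇔ (λ h → ∈-fromRel⁺ R? (across-map f (cycle₄-adj i j h)))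
                              (λ e → adj-cycle₄ i j (across-map⁻ inj (∈-fromRel⁻ R? e)))
    }
    where
    P? = corner? a c b d
    R? = across? a c b d
    f : Fin 4 → Fin n
    f = lookupˡ (a ∷ b ∷ c ∷ d ∷ [])
    inj : Injective _≡_ _≡_ f
    inj {i} {j} = lookup-injective (quad-unique q) i j
    flipped : ∀ {u v} → Across a c b d u v → Across a c b d v u
    flipped (inj₁ (p , q)) = inj₂ (q , p)
    flipped (inj₂ (p , q)) = inj₁ (q , p)
    source : ∀ {u v} → Across a c b d u v → Among a c u ⊎ Among b d u
    source = Sum.map proj₁ proj₁
    forward : ∀ {u v} → Among a c u × Among b d v → Adj u v
    forward (inj₁ refl , inj₁ refl) = ab
    forward (inj₁ refl , inj₂ refl) = ad
    forward (inj₂ refl , inj₁ refl) = cb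
    forward (inj₂ refl , inj₂ refl) = cd
    adj : ∀ {u v} → Across a c b d u v → Adj u v
    adj (inj₁ h)       = forward h
    adj (inj₂ (p , q)) = Graph.sym G (forward (q , p))
    corner : ∀ {v} → ∃[ i ] f i ≡ v → Among a c v ⊎ Among b d v
    corner (zero , e) = inj₁ (inj₁ (sym e))
    corner (suc zero , e) = inj₂ (inj₁ (sym e))
    corner (suc (suc zero) , e) = inj₁ (inj₂ (sym e))
    corner (suc (suc (suc zero)) , e) = inj₂ (inj₂ (sym e))
    preimage : ∀ {v} → Among a c v ⊎ Among b d v → ∃[ i ] f i ≡ v
    preimage (inj₁ (inj₁ e)) = i₀ , sym e
    preimage (inj₁ (inj₂ e)) = i₂ , sym e
    preimage (inj₂ (inj₁ e)) = i₁ , sym e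
    preimage (inj₂ (inj₂ e)) = i₃ , sym e

  -- Double counting of pairs of a copy and a labelling of it: a copy has at least eight labellings,
  -- and a labelling determines its copy.
  8copies≤quads : 8 * copies (cycle 4) G ≤ quads
  8copies≤quads = begin
    8 * copies (cycle 4) G
      ≡⟨ trans (cong (8 *_) copies≡∑) (sym (∑-*ˡ 8 _ (allSubgraphs n))) ⟩
    (∑[ S ← allSubgraphs n ] 8 * ι (fourCycleCopy? S))
      ≤⟨ ∑-mono (allSubgraphs n) (λ S → ℕ.≤-trans (ℕ.≤-reflexive (ℕ.*-comm 8 (ι (fourCycleCopy? S))))
           (ι-*-bound (fourCycleCopy? S) (eight S))) ⟩
    (∑[ S ← allSubgraphs n ] ∑₄ (λ a c b d → ι (is? S a c b d)))
      ≡⟨ ∑-∑₄-swap (allSubgraphs n) _ ⟩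
    ∑₄ (λ a c b d → ∑[ S ← allSubgraphs n ] ι (is? S a c b d))
      ≤⟨ ∑₄-mono once ⟩
    quads ∎
    where
    open ℕ.≤-Reasoning
    is? : ∀ S a c b d → Dec (Quad a c b d × S ≡ fourCycle a c b d)
    is? S a c b d = quad? a c b d ×-dec subgraph-≟ S (fourCycle a c b d)
    once : ∀ a c b d → ∑[ S ← allSubgraphs n ] ι (is? S a c b d) ≤ ι (quad? a c b d)
    once a c b d = begin
      (∑[ S ← allSubgraphs n ] ι (is? S a c b d))
        ≡⟨ trans (∑-cong (allSubgraphs n) λ S → ι-× (quad? a c b d) (subgraph-≟ S (fourCycle a c b d)))
             (∑-*ˡ (ι (quad? a c b d)) _ (allSubgraphs n)) ⟩
      ι (quad? a c b d) * (∑[ S ← allSubgraphs n ] ι (subgraph-≟ S (fourCycle a c b d)))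
        ≤⟨ ℕ.*-monoʳ-≤ (ι (quad? a c b d)) (∑ι≤1 (λ S → subgraph-≟ S (fourCycle a c b d)) (allSubgraphs-unique n)
             λ e e′ → trans e (sym e′)) ⟩
      ι (quad? a c b d) * 1 ≡⟨ ℕ.*-identityʳ _ ⟩
      ι (quad? a c b d) ∎
    module _ (S : Subgraph n) where
      Is : (a c b d : Fin n) → Set
      Is a c b d = Quad a c b d × S ≡ fourCycle a c b d
      swapʳ : ∀ {a c b d} → Is a c b d → Is a c d b
      swapʳ (q , e) = quad-swapʳ q , trans e (fourCycle-swapʳ _ _ _ _)
      swapˡ : ∀ {a c b d} → Is a c b d → Is c a b d
      swapˡ (q , e) = quad-swapˡ q , trans e (fourCycle-swapˡ _ _ _ _)
      sides : ∀ {a c b d} → Is a c b d → Is b d a c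
      sides (q , e) = quad-sides q , trans e (fourCycle-sides _ _ _ _)
      inner : Fin n → Fin n → ℕ
      inner a c = ∑[ b ← V ] ∑[ d ← V ] ι (is? S a c b d)
      two : ∀ {a c b d} → Is a c b d → 2 ≤ inner a c
      two {a} {c} {b} {d} i@((_ , b≢d , _) , _) = ℕ.≤-trans
        (ℕ.+-mono-≤ (term i) (ℕ.≤-trans (term (swapʳ i)) (ℕ.m≤m+n _ 0)))
        (∑-⊆ (λ b → ∑[ d ← V ] ι (is? S a c b d)) V ((b≢d ∷ []) ∷ [] ∷ []) λ {x} _ → ∈V x)
        where
        term : ∀ {b d} → Is a c b d → 1 ≤ ∑[ d ← V ] ι (is? S a c b d)
        term {b} {d} i = ℕ.≤-trans (ι-yes (is? S a c b d) i) (∑-term (λ d → ι (is? S a c b d)) V (∈V d))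
      outer : ∀ {a c b d} → Is a c b d → 2 ≤ ∑[ c ← V ] inner a c
      outer {a} {c} i = ℕ.≤-trans (two i) (∑-term (inner a) V (∈V c))
      -- Any of the four corners can stand first, and for each of them the two vertices of the other
      -- diagonal come in either order.
      eight : IsCopy (cycle 4) G S → 8 ≤ ∑₄ (λ a c b d → ι (is? S a c b d))
      eight copy with copy⇒quad S copy
      ... | a , c , b , d , i = ℕ.≤-trans
        (ℕ.+-mono-≤ (outer i) (ℕ.+-mono-≤ (outer (sides i)) (ℕ.+-mono-≤ (outer (swapˡ i))
          (ℕ.≤-trans (outer (sides (swapʳ i))) (ℕ.m≤m+n _ 0)))))
        (∑-⊆ (λ a → ∑[ c ← V ] inner a c) V (quad-unique (proj₁ i)) λ {x} _ → ∈V x)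

-- Complete bipartite graphs: their cycles and their four-cycles.

ordered-pairs : {P : Pred (Fin n) 0ℓ} (P? : Decidable P) → count P? * count P? ≤
  2 * (∑[ a ← V ] ∑[ c ← V ] ι ((a Fin.<? c) ×-dec (P? a ×-dec P? c))) + count P?
ordered-pairs {P = P} P? = begin
  count P? * count P?
    ≡⟨ sym (∑-* V V _ _) ⟩
  (∑[ a ← V ] ∑[ c ← V ] ι (P? a) * ι (P? c))
    ≤⟨ ∑₂-mono (λ a c → ι-*-bound (P? a) λ p → ι-bound (P? c) λ q → split p q) ⟩
  (∑[ a ← V ] ∑[ c ← V ] (ι (less? a c) + ι (less? c a)) + ι (equal? a c))
    ≡⟨ trans (∑₂-+ _ _) (cong (_+ (∑[ a ← V ] ∑[ c ← V ] ι (equal? a c)))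
         (trans (∑₂-+ _ _) (cong (_+_ less) (trans (∑-swap V V _) (sym (ℕ.+-identityʳ less)))))) ⟩
  2 * less + (∑[ a ← V ] ∑[ c ← V ] ι (equal? a c))
    ≤⟨ ℕ.+-monoʳ-≤ (2 * less) (∑-mono V diagonal) ⟩
  2 * less + count P? ∎
  where
  open ℕ.≤-Reasoning
  less? : ∀ a c → Dec (a Fin.< c × P a × P c)
  less? a c = (a Fin.<? c) ×-dec (P? a ×-dec P? c)
  equal? : ∀ a c → Dec (a ≡ c × P a)
  equal? a c = (a Fin.≟ c) ×-dec P? a
  less : ℕ
  less = ∑[ a ← V ] ∑[ c ← V ] ι (less? a c)
  split : ∀ {a c} → P a → P c → 1 ≤ ι (less? a c) + ι (less? c a) + ι (equal? a c)
  split {a} {c} p q with Fin.<-cmp a c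
  ... | tri< a<c _ _ = ℕ.≤-trans (ι-yes (less? a c) (a<c , p , q)) (ℕ.≤-trans (ℕ.m≤m+n _ _) (ℕ.m≤m+n _ _))
  ... | tri≈ _ a≡c _ = ℕ.≤-trans (ι-yes (equal? a c) (a≡c , p)) (ℕ.m≤n+m _ (ι (less? a c) + ι (less? c a)))
  ... | tri> _ _ c<a = ℕ.≤-trans (ι-yes (less? c a) (c<a , q , p)) (ℕ.≤-trans (ℕ.m≤n+m _ (ι (less? a c))) (ℕ.m≤m+n _ _))
  diagonal : ∀ a → ∑[ c ← V ] ι (equal? a c) ≤ ι (P? a)
  diagonal a = begin
    (∑[ c ← V ] ι (equal? a c))             ≡⟨ trans (∑-cong V λ c → ι-× (a Fin.≟ c) (P? a)) (∑-*ʳ _ (ι (P? a)) V) ⟩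
    (∑[ c ← V ] ι (a Fin.≟ c)) * ι (P? a)   ≤⟨ ℕ.*-monoˡ-≤ (ι (P? a)) (∑ι≤1 (a Fin.≟_) V-unique λ p q → trans (sym p) q) ⟩
    1 * ι (P? a)                            ≡⟨ ℕ.*-identityˡ _ ⟩
    ι (P? a)                                ∎

count-below : ∀ s → s ≤ n → count {n} (λ i → toℕ i ℕ.<? s) ≡ s
count-below {n} zero _ = ℕ.n≤0⇒n≡0 (ℕ.≤-trans (∑-mono (V {n}) λ i → ι-no (toℕ i ℕ.<? 0) λ ())
  (ℕ.≤-reflexive (trans (∑V-const 0) (ℕ.*-zeroʳ n))))
count-below {suc n} (suc s) (s≤s s≤n) = trans (∑V-suc _) (cong₂ _+_
  (ℕ.≤-antisym (ι≤1 (0 ℕ.<? suc s)) (ι-yes (0 ℕ.<? suc s) z<s))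
  (trans (∑-cong V λ i → ι-cong (suc (toℕ i) ℕ.<? suc s) (toℕ i ℕ.<? s) s<s⁻¹ s<s) (count-below s s≤n)))

count-above : ∀ s → s ≤ n → s + count {n} (λ i → s ℕ.≤? toℕ i) ≡ n
count-above {n} s s≤n = begin
  s + count (λ i → s ℕ.≤? toℕ i)
    ≡⟨ cong (_+ count {n} (λ i → s ℕ.≤? toℕ i)) (sym (count-below s s≤n)) ⟩
  count (λ i → toℕ i ℕ.<? s) + count {n} (λ i → s ℕ.≤? toℕ i)
    ≡⟨ sym (∑-+ _ _ V) ⟩
  (∑[ i ← V ] ι (toℕ i ℕ.<? s) + ι (s ℕ.≤? toℕ i))
    ≡⟨ ∑-cong V (λ i → one (toℕ i ℕ.<? s) (s ℕ.≤? toℕ i)) ⟩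
  ∑ (V {n}) (λ _ → 1)
    ≡⟨ trans (∑V-const 1) (ℕ.*-identityʳ n) ⟩
  n ∎
  where
  open ≡-Reasoning
  one : ∀ {x} (p : Dec (x < s)) (q : Dec (s ≤ x)) → ι p + ι q ≡ 1
  one (yes p) (yes q) = contradiction q (ℕ.<⇒≱ p)
  one (yes p) (no _)  = refl
  one (no _)  (yes _) = refl
  one (no ¬p) (no ¬q) = contradiction (ℕ.≰⇒> ¬q) ¬p

-- The side of a bipartition reached from side `b` after `t` steps.
flips : ℕ → Bool → Bool
flips zero    b = b
flips (suc t) b = not (flips t b)

flips-even : ∀ t {b} → flips t b ≡ b → 2 ∣ t
flips-even zero          e = divides 0 refl
flips-even (suc zero)    {false} ()
flips-even (suc zero)    {true}  ()
flips-even (suc (suc t)) e with flips-even t (trans (sym (Bool.not-involutive _)) e)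
... | divides q refl = divides (suc q) refl

among-ordered : {a c a′ c′ : Fin n} → a Fin.< c → a′ Fin.< c′ → Among a′ c′ a → Among a′ c′ c → a ≡ a′ × c ≡ c′
among-ordered lt lt′ (inj₁ refl) (inj₁ refl) = contradiction lt (ℕ.<-irrefl refl)
among-ordered lt lt′ (inj₁ refl) (inj₂ refl) = refl , refl
among-ordered lt lt′ (inj₂ refl) (inj₁ refl) = contradiction (ℕ.<-trans lt lt′) (ℕ.<-irrefl refl)
among-ordered lt lt′ (inj₂ refl) (inj₂ refl) = contradiction lt (ℕ.<-irrefl refl)

module Bipartite (s n : ℕ) where

  Left Right : Pred (Fin n) 0ℓ
  Left i = toℕ i < s
  Right i = s ≤ toℕ i

  left? : Decidable Left
  left? i = toℕ i ℕ.<? s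

  right? : Decidable Right
  right? i = s ℕ.≤? toℕ i

  completeBipartite : Graph n
  completeBipartite = record
    { Adj    = λ i j → (Left i × Right j) ⊎ (Right i × Left j)
    ; adj?   = λ i j → (left? i ×-dec right? j) ⊎-dec (right? i ×-dec left? j)
    ; sym    = λ { (inj₁ (l , r)) → inj₂ (r , l) ; (inj₂ (r , l)) → inj₁ (l , r) }
    ; irrefl = λ { refl (inj₁ (l , r)) → ℕ.<⇒≱ l r ; refl (inj₂ (r , l)) → ℕ.<⇒≱ l r }
    }

  open Graph completeBipartite using (Adj)
  open Quads completeBipartite using (Quad)
  open Copies completeBipartite

  side-flips : ∀ {i j} → Adj i j → does (left? j) ≡ not (does (left? i))
  side-flips {i} {j} (inj₁ (l , r)) =
    trans (dec-false (left? j) (ℕ.≤⇒≯ r)) (cong not (sym (dec-true (left? i) l)))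
  side-flips {i} {j} (inj₂ (r , l)) =
    trans (dec-true (left? j) l) (cong not (sym (dec-false (left? i) (ℕ.≤⇒≯ r))))

  -- Every step changes sides and the last vertex is followed by the first, so `m` changes restore
  -- the initial side.
  cycle-even : ∀ {m} → 2 ≤ m → Contains completeBipartite (cycle m) → 2 ∣ m
  cycle-even {m@(suc (suc m′))} (s≤s (s≤s _)) c with contains⇒embedding {H = cycle m} {completeBipartite} c
  ... | f , _ , adj = flips-even m {side zero} (sym (trans (step (Fin.fromℕ (suc m′)) zero
          (inj₂ (cong suc (Fin.toℕ-fromℕ (suc m′)) , refl))
          (λ e → contradiction (trans (sym (Fin.toℕ-fromℕ (suc m′))) (cong toℕ e)) λ ()))
        (cong not (walk (suc m′) (Fin.fromℕ (suc m′)) (Fin.toℕ-fromℕ (suc m′))))))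
    where
    side : Fin m → Bool
    side i = does (left? (f i))
    step : ∀ i j → Successive i j → i ≢ j → side j ≡ not (side i)
    step i j e i≢j = side-flips (adj {i} {j} (i≢j , inj₁ e))
    walk : ∀ t (i : Fin m) → toℕ i ≡ t → side i ≡ flips t (side zero)
    walk zero    zero    e = refl
    walk (suc t) (suc i) e = trans
      (step (Fin.inject₁ i) (suc i) (inj₁ (cong suc (Fin.toℕ-inject₁ i)))
        (λ e′ → ℕ.<-irrefl (trans (sym (Fin.toℕ-inject₁ i)) (cong toℕ e′)) ℕ.≤-refl))
      (cong not (walk t (Fin.inject₁ i) (trans (Fin.toℕ-inject₁ i) (ℕ.suc-injective e))))

  -- One of the vertices 2p, 2p + 1 of the cycle is on the left.
  cycle-short : ∀ t → Contains completeBipartite (cycle (t * 2)) → t ≤ s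
  cycle-short t c with contains⇒embedding {H = cycle (t * 2)} {completeBipartite} c
  ... | f , f-inj , adj = Fin.injective⇒≤ {f = λ p → fromℕ< (proj₂ (proj₂ (pick p)))} λ {p} {q} e →
    Fin.toℕ-injective (trans (sym (proj₁ (proj₂ (pick p)))) (trans
      (cong (⌊_/2⌋ ∘ toℕ) (f-inj (Fin.toℕ-injective (trans (sym (Fin.toℕ-fromℕ< (proj₂ (proj₂ (pick p)))))
        (trans (cong toℕ e) (Fin.toℕ-fromℕ< (proj₂ (proj₂ (pick q)))))))))
      (proj₁ (proj₂ (pick q)))))
    where
    half : ∀ p → ⌊ p * 2 /2⌋ ≡ p
    half zero    = refl
    half (suc p) = cong suc (half p)
    half′ : ∀ p → ⌊ suc (p * 2) /2⌋ ≡ p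
    half′ zero    = refl
    half′ (suc p) = cong suc (half′ p)
    pick : ∀ (p : Fin t) → ∃[ i ] ⌊ toℕ i /2⌋ ≡ toℕ p × Left (f i)
    pick p = [ (λ (l , _) → i , trans (cong ⌊_/2⌋ i≡) (half (toℕ p)) , l)
             , (λ (_ , l) → j , trans (cong ⌊_/2⌋ j≡) (half′ (toℕ p)) , l) ]′
      (adj {i} {j} ((λ e → ℕ.<-irrefl (trans (sym i≡) (trans (cong toℕ e) j≡)) ℕ.≤-refl) ,
        inj₁ (inj₁ (trans (cong suc i≡) (sym j≡)))))
      where
      j< : suc (toℕ p * 2) < t * 2
      j< = ℕ.*-monoˡ-≤ 2 (Fin.toℕ<n p)
      i j : Fin (t * 2)
      i = fromℕ< (ℕ.<-trans (ℕ.n<1+n _) j<)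
      j = fromℕ< j<
      i≡ : toℕ i ≡ toℕ p * 2
      i≡ = Fin.toℕ-fromℕ< _
      j≡ : toℕ j ≡ suc (toℕ p * 2)
      j≡ = Fin.toℕ-fromℕ< _

  -- Selects one of the eight labellings of a four-cycle: the left diagonal comes first and each
  -- diagonal is increasing.
  Canonical : (a c b d : Fin n) → Set
  Canonical a c b d = (a Fin.< c × Left a × Left c) × (b Fin.< d × Right b × Right d)

  leftPair? : ∀ a c → Dec (a Fin.< c × Left a × Left c)
  leftPair? a c = (a Fin.<? c) ×-dec (left? a ×-dec left? c)

  rightPair? : ∀ b d → Dec (b Fin.< d × Right b × Right d)
  rightPair? b d = (b Fin.<? d) ×-dec (right? b ×-dec right? d)

  canonical? : ∀ a c b d → Dec (Canonical a c b d)
  canonical? a c b d = leftPair? a c ×-dec rightPair? b d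

  canonical⇒quad : ∀ {a c b d} → Canonical a c b d → Quad a c b d
  canonical⇒quad ((a<c , la , lc) , (b<d , rb , rd)) =
    (λ { refl → ℕ.<-irrefl refl a<c }) , (λ { refl → ℕ.<-irrefl refl b<d }) ,
    inj₁ (la , rb) , inj₁ (lc , rb) , inj₁ (la , rd) , inj₁ (lc , rd)

  -- Already the vertex set suffices: its left part is the first diagonal, its right part the
  -- second, and the order settles the rest.
  canonical-unique : ∀ {a c b d a′ c′ b′ d′} → Canonical a c b d → Canonical a′ c′ b′ d′ →
    fourCycle a c b d ≡ fourCycle a′ c′ b′ d′ → (a ≡ a′ × c ≡ c′) × (b ≡ b′ × d ≡ d′)
  canonical-unique {a} {c} {b} {d} {a′} {c′} {b′} {d′}
    ((a<c , la , lc) , (b<d , rb , rd)) ((a<c′ , la′ , lc′) , (b<d′ , rb′ , rd′)) e =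
    among-ordered a<c a<c′ (leftOf la (moved (inj₁ (inj₁ refl)))) (leftOf lc (moved (inj₁ (inj₂ refl)))) ,
    among-ordered b<d b<d′ (rightOf rb (moved (inj₂ (inj₁ refl)))) (rightOf rd (moved (inj₂ (inj₂ refl))))
    where
    Corner′ : Fin n → Set
    Corner′ v = Among a′ c′ v ⊎ Among b′ d′ v
    moved : ∀ {v} → Among a c v ⊎ Among b d v → Corner′ v
    moved {v} h = ∈-fromDec⁻ (corner? a′ c′ b′ d′) (subst (λ S → v Subset.∈ Subgraph.vertices S) e
      (∈-fromDec⁺ (corner? a c b d) h))
    leftOf : ∀ {v} → Left v → Corner′ v → Among a′ c′ v
    leftOf l (inj₁ h)           = h
    leftOf l (inj₂ (inj₁ refl)) = contradiction rb′ (ℕ.<⇒≱ l)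
    leftOf l (inj₂ (inj₂ refl)) = contradiction rd′ (ℕ.<⇒≱ l)
    rightOf : ∀ {v} → Right v → Corner′ v → Among b′ d′ v
    rightOf r (inj₂ h)           = h
    rightOf r (inj₁ (inj₁ refl)) = contradiction r (ℕ.<⇒≱ la′)
    rightOf r (inj₁ (inj₂ refl)) = contradiction r (ℕ.<⇒≱ lc′)

  private
    Tuple : Set
    Tuple = (Fin n × Fin n) × (Fin n × Fin n)

  tuples : List Tuple
  tuples = cartesianProduct (cartesianProduct V V) (cartesianProduct V V)

  tuples-unique : Unique tuples
  tuples-unique = Unique.cartesianProduct⁺ VV VV
    where VV = Unique.cartesianProduct⁺ (V-unique {n}) (V-unique {n})

  ∑-tuples : (f : Tuple → ℕ) → ∑ tuples f ≡ ∑₄ (λ a c b d → f ((a , c) , (b , d)))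
  ∑-tuples f = trans (∑-cartesianProduct f (cartesianProduct V V) (cartesianProduct V V)) (trans (∑-cartesianProduct _ V V)
    (∑-cong V λ a → ∑-cong V λ c → ∑-cartesianProduct (λ q → f ((a , c) , q)) V V))

  -- The double counting in the opposite direction: every canonical labelling has its copy, and a
  -- copy has at most one canonical labelling.
  canonical≤copies : ∑₄ (λ a c b d → ι (canonical? a c b d)) ≤ copies (cycle 4) completeBipartite
  canonical≤copies = begin
    ∑₄ (λ a c b d → ι (canonical? a c b d))
      ≤⟨ ∑₄-mono present ⟩
    ∑₄ (λ a c b d → ∑[ S ← allSubgraphs n ] ι (copyOf? S ((a , c) , (b , d))))
      ≡⟨ sym (∑-tuples (λ t → ∑[ S ← allSubgraphs n ] ι (copyOf? S t))) ⟩
    (∑[ t ← tuples ] ∑[ S ← allSubgraphs n ] ι (copyOf? S t))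
      ≡⟨ ∑-swap tuples (allSubgraphs n) _ ⟩
    (∑[ S ← allSubgraphs n ] ∑[ t ← tuples ] ι (copyOf? S t))
      ≤⟨ ∑-mono (allSubgraphs n) once ⟩
    (∑[ S ← allSubgraphs n ] ι (fourCycleCopy? S))
      ≡⟨ sym copies≡∑ ⟩
    copies (cycle 4) completeBipartite ∎
    where
    open ℕ.≤-Reasoning
    is? : ∀ S t → let ((a , c) , (b , d)) = t in Dec (Canonical a c b d × S ≡ fourCycle a c b d)
    is? S ((a , c) , (b , d)) = canonical? a c b d ×-dec subgraph-≟ S (fourCycle a c b d)
    copyOf? : ∀ S t → Dec (IsCopy (cycle 4) completeBipartite S × _)
    copyOf? S t = fourCycleCopy? S ×-dec is? S t
    present : ∀ a c b d → ι (canonical? a c b d) ≤ ∑[ S ← allSubgraphs n ] ι (copyOf? S ((a , c) , (b , d)))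
    present a c b d = ℕ.≤-trans
      (ι-mono (canonical? a c b d) (copyOf? (fourCycle a c b d) ((a , c) , (b , d)))
        λ h → quad⇒copy (canonical⇒quad h) , h , refl)
      (∑-term (λ S → ι (copyOf? S ((a , c) , (b , d)))) (allSubgraphs n) (allSubgraphs-complete (fourCycle a c b d)))
    once : ∀ S → ∑[ t ← tuples ] ι (copyOf? S t) ≤ ι (fourCycleCopy? S)
    once S = begin
      (∑[ t ← tuples ] ι (copyOf? S t))
        ≡⟨ trans (∑-cong tuples λ t → ι-× (fourCycleCopy? S) (is? S t)) (∑-*ˡ (ι (fourCycleCopy? S)) _ tuples) ⟩
      ι (fourCycleCopy? S) * (∑[ t ← tuples ] ι (is? S t))
        ≤⟨ ℕ.*-monoʳ-≤ (ι (fourCycleCopy? S)) (∑ι≤1 (is? S) tuples-unique λ {t} {t′} → same t t′) ⟩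
      ι (fourCycleCopy? S) * 1
        ≡⟨ ℕ.*-identityʳ _ ⟩
      ι (fourCycleCopy? S) ∎
      where
      same : ∀ t t′ → _ → _ → t ≡ t′
      same ((a , c) , (b , d)) ((a′ , c′) , (b′ , d′)) (h , e) (h′ , e′)
        with canonical-unique h h′ (trans (sym e) e′)
      ... | (refl , refl) , (refl , refl) = refl

  -- A four-cycle is a choice of two vertices on each side. The factor 4 clears the denominators of
  -- the two binomial coefficients.
  fourCycles≥ : ∀ m → s + m ≡ n → (s * s ∸ s) * (m * m ∸ m) ≤ 4 * copies (cycle 4) completeBipartite
  fourCycles≥ m e = begin
    (s * s ∸ s) * (m * m ∸ m)   ≤⟨ ℕ.*-mono-≤ (pairs left? s #left) (pairs right? m #right) ⟩
    2 * lefts * (2 * rights)             ≡⟨ regroup lefts rights ⟩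
    4 * (lefts * rights)                 ≡⟨ cong (4 *_) (sym product) ⟩
    4 * ∑₄ (λ a c b d → ι (canonical? a c b d)) ≤⟨ ℕ.*-monoʳ-≤ 4 canonical≤copies ⟩
    4 * copies (cycle 4) completeBipartite ∎
    where
    open ℕ.≤-Reasoning
    lefts rights : ℕ
    lefts = ∑[ a ← V ] ∑[ c ← V ] ι (leftPair? a c)
    rights = ∑[ b ← V ] ∑[ d ← V ] ι (rightPair? b d)
    regroup : ∀ x y → 2 * x * (2 * y) ≡ 4 * (x * y)
    regroup = solve-∀
    s≤n : s ≤ n
    s≤n = subst (s ≤_) e (ℕ.m≤m+n s m)
    #left : count left? ≡ s
    #left = count-below s s≤n
    #right : count right? ≡ m
    #right = ℕ.+-cancelˡ-≡ s _ _ (trans (count-above s s≤n) (sym e))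
    pairs : {P : Pred (Fin n) 0ℓ} (P? : Decidable P) (m : ℕ) → count P? ≡ m →
            m * m ∸ m ≤ 2 * (∑[ a ← V ] ∑[ c ← V ] ι ((a Fin.<? c) ×-dec (P? a ×-dec P? c)))
    pairs P? m refl = ℕ.≤-trans (ℕ.∸-monoˡ-≤ (count P?) (ordered-pairs P?))
      (ℕ.≤-reflexive (ℕ.m+n∸n≡m _ (count P?)))
    product : ∑₄ (λ a c b d → ι (canonical? a c b d)) ≡ lefts * rights
    product = trans (∑-cong V λ a → ∑-cong V λ c →
      trans (∑-cong V λ b → trans (∑-cong V λ d → ι-× (leftPair? a c) (rightPair? b d)) (∑-*ˡ (ι (leftPair? a c)) _ V))
        (∑-*ˡ (ι (leftPair? a c)) _ V)) (∑₂-* rights _)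

-- From inequalities of natural numbers to the asymptotic relation.

-- The error term of f against g = G / (1 + q′), where x = (1 + q′) f; junk at G = 0.
relativeError : (x G : ℕ) → ℚ
relativeError x zero    = 0ℚ
relativeError x (suc g) = ℚ.fromℚᵘ (mkℚᵘ (+ x ℤ.- + suc g) g)

fromℚᵘ-homo-* : ∀ p q → ℚ.fromℚᵘ p ℚ.* ℚ.fromℚᵘ q ≡ ℚ.fromℚᵘ (p ℚᵘ.* q)
fromℚᵘ-homo-* p q = ℚ.toℚᵘ-injective (ℚᵘ.≃-trans (ℚ.toℚᵘ-homo-* (ℚ.fromℚᵘ p) (ℚ.fromℚᵘ q))
  (ℚᵘ.≃-trans (ℚᵘ.*-cong (ℚ.toℚᵘ-fromℚᵘ p) (ℚ.toℚᵘ-fromℚᵘ q)) (ℚᵘ.≃-sym (ℚ.toℚᵘ-fromℚᵘ (p ℚᵘ.* q)))))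

fromℚᵘ-homo-+ : ∀ p q → ℚ.fromℚᵘ p ℚ.+ ℚ.fromℚᵘ q ≡ ℚ.fromℚᵘ (p ℚᵘ.+ q)
fromℚᵘ-homo-+ p q = ℚ.toℚᵘ-injective (ℚᵘ.≃-trans (ℚ.toℚᵘ-homo-+ (ℚ.fromℚᵘ p) (ℚ.fromℚᵘ q))
  (ℚᵘ.≃-trans (ℚᵘ.+-cong (ℚ.toℚᵘ-fromℚᵘ p) (ℚ.toℚᵘ-fromℚᵘ q)) (ℚᵘ.≃-sym (ℚ.toℚᵘ-fromℚᵘ (p ℚᵘ.+ q)))))

relativeError-correct : ∀ f r q′ N G → r * N ≡ suc G →
  fromℕ f ≡ (1ℚ ℚ.+ relativeError (suc q′ * f) (r * N)) ℚ.* ((+ r / suc q′) ℚ.* fromℕ N)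
relativeError-correct f r q′ N G e rewrite e = sym (begin
  (ℚ.fromℚᵘ one ℚ.+ ℚ.fromℚᵘ err) ℚ.* (ℚ.fromℚᵘ (mkℚᵘ (+ r) q′) ℚ.* ℚ.fromℚᵘ (mkℚᵘ (+ N) 0))
    ≡⟨ cong₂ ℚ._*_ (fromℚᵘ-homo-+ one err) (fromℚᵘ-homo-* (mkℚᵘ (+ r) q′) (mkℚᵘ (+ N) 0)) ⟩
  ℚ.fromℚᵘ (one ℚᵘ.+ err) ℚ.* ℚ.fromℚᵘ (mkℚᵘ (+ r) q′ ℚᵘ.* mkℚᵘ (+ N) 0)
    ≡⟨ fromℚᵘ-homo-* (one ℚᵘ.+ err) (mkℚᵘ (+ r) q′ ℚᵘ.* mkℚᵘ (+ N) 0) ⟩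
  ℚ.fromℚᵘ product
    ≡⟨ ℚ.fromℚᵘ-cong {product} {mkℚᵘ (+ f) 0} (ℚᵘ.*≡* cross) ⟩
  ℚ.fromℚᵘ (mkℚᵘ (+ f) 0) ∎)
  where
  open ≡-Reasoning
  one err product : ℚᵘ.ℚᵘ
  one = mkℚᵘ (+ 1) 0
  err = mkℚᵘ (+ (suc q′ * f) ℤ.- + suc G) G
  product = (one ℚᵘ.+ err) ℚᵘ.* (mkℚᵘ (+ r) q′ ℚᵘ.* mkℚᵘ (+ N) 0)
  rN : + r ℤ.* + N ≡ + suc G
  rN = trans (sym (ℤ.pos-* r N)) (cong +_ e)
  ring : ∀ q f g → (+ 1 ℤ.* g ℤ.+ (q ℤ.* f ℤ.- g) ℤ.* + 1) ℤ.* g ℤ.* + 1 ≡ f ℤ.* ((+ 1 ℤ.* g) ℤ.* (q ℤ.* + 1))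
  ring = ℤ-Solver.solve-∀
  cross : ℚᵘ.↥ product ℤ.* + 1 ≡ + f ℤ.* ℚᵘ.↧ product
  cross = trans (cong₂ (λ y z → (+ 1 ℤ.* + suc G ℤ.+ (y ℤ.- + suc G) ℤ.* + 1) ℤ.* z ℤ.* + 1)
    (ℤ.pos-* (suc q′) f) rN) (ring (+ suc q′) (+ f) (+ suc G))

-- The bound is ε = (a + 1)/(d + 1). The multiplier d + 2 instead of d + 1 yields strictness: the
-- error is at most 1/(d + 2), which is below 1/(d + 1) ≤ ε.
relativeError-small : ∀ x g m a d .{c : Coprime (suc a) (suc d)} →
  suc (suc d) * x ≤ suc (suc d) * suc g + m → suc (suc d) * suc g ≤ suc (suc d) * x + m → m ≤ suc g →
  ℚ.∣ relativeError x (suc g) ∣ ℚ.< ℚ.mkℚ ℤ.+[1+ a ] d c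
relativeError-small x g m a d upper lower m≤ = ℚ.toℚᵘ-cancel-<
  (ℚᵘ.<-respˡ-≃ (ℚᵘ.≃-sym (ℚᵘ.≃-trans (ℚ.toℚᵘ-homo-∣-∣ (relativeError x (suc g)))
      (ℚᵘ.∣-∣-cong (ℚ.toℚᵘ-fromℚᵘ (mkℚᵘ (+ x ℤ.- + suc g) g)))))
    (ℚᵘ.*<* (subst₂ ℤ._<_ (ℤ.pos-* ℤ.∣ diff ∣ (suc d)) (ℤ.pos-* (suc a) (suc g)) (ℤ.+<+ small))))
  where
  diff : ℤ.ℤ
  diff = + x ℤ.- + suc g
  gap : ∀ x y → suc (suc d) * x ≤ suc (suc d) * y + m → suc (suc d) * (x ∸ y) ≤ m
  gap x y h = subst (_≤ m) (sym (ℕ.*-distribˡ-∸ (suc (suc d)) x y)) (ℕ.m≤n+o⇒m∸n≤o _ _ h)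
  close : suc (suc d) * ℤ.∣ diff ∣ ≤ m
  close with ℕ.≤-total (suc g) x
  ... | inj₁ g≤x = subst (λ z → suc (suc d) * z ≤ m)
    (sym (trans (cong ℤ.∣_∣ (ℤ.m-n≡m⊖n x (suc g))) (cong ℤ.∣_∣ (ℤ.⊖-≥ g≤x))))
    (gap x (suc g) upper)
  ... | inj₂ x≤g = subst (λ z → suc (suc d) * z ≤ m) (sym (trans (cong ℤ.∣_∣ (ℤ.m-n≡m⊖n x (suc g))) (ℤ.∣⊖∣-≤ x≤g)))
    (gap (suc g) x lower)
  small : ℤ.∣ diff ∣ * suc d < suc a * suc g
  small = ℕ.<-≤-trans (strict ℤ.∣ diff ∣ close) (ℕ.m≤m+n (suc g) (a * suc g))
    where
    strict : ∀ z → suc (suc d) * z ≤ m → z * suc d < suc g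
    strict zero    _ = z<s
    strict (suc z) h = ℕ.<-≤-trans (ℕ.m<n+m (suc z * suc d) {suc z} z<s)
      (ℕ.≤-trans (ℕ.≤-reflexive (cong (_+_ (suc z)) (ℕ.*-comm (suc z) (suc d)))) (ℕ.≤-trans h m≤))

-- The hypothesis says, free of division, that `suc q′ * f n` and `r * n ^ p` differ by at most n^p
-- / t. As `r` is positive, this is a relative error of at most 1/t.
∼-intro : ∀ f r q′ p → 1 ≤ r →
  (∀ t → ∃[ N ] ∀ n → N ≤ n → t * (suc q′ * f n) ≤ t * (r * n ^ p) + n ^ p
                            × t * (r * n ^ p) ≤ t * (suc q′ * f n) + n ^ p) →
  f ∼ (λ n → (+ r / suc q′) ℚ.* fromℕ (n ^ p))
∼-intro f r q′ p 1≤r close = δ , tends , 1 , λ n 1≤n → let (g , e) = nonzero n 1≤n in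
  relativeError-correct (f n) r q′ (n ^ p) g e
  where
  δ : ℕ → ℚ
  δ n = relativeError (suc q′ * f n) (r * n ^ p)
  power≥1 : ∀ n → 1 ≤ n → 1 ≤ n ^ p
  power≥1 n 1≤n = subst (_≤ n ^ p) (ℕ.^-zeroˡ p) (ℕ.^-monoˡ-≤ p 1≤n)
  nonzero : ∀ n → 1 ≤ n → ∃[ g ] r * n ^ p ≡ suc g
  nonzero n 1≤n with r * n ^ p | ℕ.*-mono-≤ 1≤r (power≥1 n 1≤n)
  ... | suc g | _ = g , refl
  tends : TendsToZero δ
  tends (ℚ.mkℚ (+ zero) d c)   0<ε = contradiction (ℚ.drop-*<* 0<ε) λ { (ℤ.+<+ ()) }
  tends (ℚ.mkℚ ℤ.-[1+ a ] d c) 0<ε = contradiction (ℚ.drop-*<* 0<ε) λ ()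
  tends ε@(ℚ.mkℚ ℤ.+[1+ a ] d c) 0<ε = let (N , bounds) = close (suc (suc d)) in
    -- The successor forces n ≥ 1, so that the denominator `r * n ^ p` of the error is positive.
    suc N , λ n N<n → let (g , e) = nonzero n (ℕ.≤-trans (s≤s z≤n) N<n)
                          (upper , lower) = bounds n (ℕ.<⇒≤ N<n)
                      in subst (λ G → ℚ.∣ relativeError (suc q′ * f n) G ∣ ℚ.< ε) (sym e)
                        (relativeError-small (suc q′ * f n) g (n ^ p) a d
                          (subst (λ G → suc (suc d) * (suc q′ * f n) ≤ suc (suc d) * G + n ^ p) e upper)
                          (subst (λ G → suc (suc d) * G ≤ suc (suc d) * (suc q′ * f n) + n ^ p) e lower)
                          (subst (n ^ p ≤_) e (subst (_≤ r * n ^ p) (ℕ.*-identityˡ (n ^ p)) (ℕ.*-monoˡ-≤ (n ^ p) 1≤r))))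

-- The two bounds when the least even length is 2k.

square≤cube : ∀ n → n * n ≤ n * (n * n)
square≤cube zero      = z≤n
square≤cube n@(suc _) = ℕ.m≤n*m (n * n) n

bipartite-free : ∀ {A : Pred ℕ 0ℓ} → (∀ {a} → a ∈ A → 3 ≤ a) → ∀ s n →
  (∀ {t} → t * 2 ∈ A → s < t) → Free (cycles A) (Bipartite.completeBipartite s n)
bipartite-free {A} A≥3 s n long (a , a∈A) c
  with Bipartite.cycle-even s n (ℕ.≤-trans (ℕ.n≤1+n 2) (A≥3 a∈A)) c
... | divides t refl = contradiction (Bipartite.cycle-short s n t c) (ℕ.<⇒≱ (long a∈A))

module _ {n k} (G : Graph n) (1≤k : 1 ≤ k) (free : ¬ Contains G (cycle (2 * k))) where
  open Quads G using (edges; quads)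
  open Walks G

  private
    D : ℕ
    D = (k ∸ 1) * (threshold k + threshold k)
    r : ℕ
    r = (k ∸ 1) * (k ∸ 2)

  quads≤edges : quads ≤ 2 * (n * (n * r)) + D * edges
  quads≤edges = ℕ.≤-trans (QuadBounds.quads≤ G k 1≤k) (ℕ.+-monoʳ-≤ _
    (ℕ.≤-trans (FatQuads.fatQuads≤ G k 1≤k free) (ℕ.≤-reflexive (regroup (k ∸ 1) edges (threshold k)))))
    where
    regroup : ∀ x e t → x * (e * t + e * t) ≡ x * (t + t) * e
    regroup = solve-∀

  edges≤ : edges ≤ n * n
  edges≤ = ℕ.≤-trans (∑₂-mono λ u v → ι≤1 (Graph.adj? G u v))
    (ℕ.≤-reflexive (trans (∑₂-const 1) (cong (n *_) (ℕ.*-identityʳ n))))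

  -- With the trivial `edges≤`, the quadruples number O(n²), and the dominant contribution to the
  -- closed walks is the 2n³ degenerate ones.
  edges⁴≤n⁷ : edges * edges * (edges * edges) ≤ (2 * r + D + 2) * (n * n * (n * n) * (n * (n * n)))
  edges⁴≤n⁷ = begin
    edges * edges * (edges * edges)      ≤⟨ edges⁴≤ ⟩
    n * n * (n * n) * codegs²            ≤⟨ ℕ.*-monoʳ-≤ (n * n * (n * n)) (walks n codegs²≤ quads≤edges edges≤) ⟩
    n * n * (n * n) * ((2 * r + D + 2) * (n * (n * n))) ≡⟨ regroup n (2 * r + D + 2) ⟩
    (2 * r + D + 2) * (n * n * (n * n) * (n * (n * n))) ∎
    where
    open ℕ.≤-Reasoning
    regroup : ∀ n x → n * n * (n * n) * (x * (n * (n * n))) ≡ x * (n * n * (n * n) * (n * (n * n)))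
    regroup = solve-∀
    walks : ∀ n {c q e} → c ≤ q + (n * (n * n) + n * (n * n)) → q ≤ 2 * (n * (n * r)) + D * e → e ≤ n * n →
            c ≤ (2 * r + D + 2) * (n * (n * n))
    walks n {c} {q} {e} h₁ h₂ h₃ = begin
      c                                                       ≤⟨ h₁ ⟩
      q + (n * (n * n) + n * (n * n))                         ≤⟨ ℕ.+-monoˡ-≤ _ h₂ ⟩
      2 * (n * (n * r)) + D * e + (n * (n * n) + n * (n * n))
        ≤⟨ ℕ.+-monoˡ-≤ (n * (n * n) + n * (n * n)) (ℕ.+-monoʳ-≤ (2 * (n * (n * r))) (ℕ.*-monoʳ-≤ D h₃)) ⟩
      2 * (n * (n * r)) + D * (n * n) + (n * (n * n) + n * (n * n)) ≡⟨ eq₁ n r D ⟩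
      (2 * r + D) * (n * n) + 2 * (n * (n * n))               ≤⟨ ℕ.+-monoˡ-≤ _ (ℕ.*-monoʳ-≤ (2 * r + D) (square≤cube n)) ⟩
      (2 * r + D) * (n * (n * n)) + 2 * (n * (n * n))         ≡⟨ sym (ℕ.*-distribʳ-+ (n * (n * n)) (2 * r + D) 2) ⟩
      (2 * r + D + 2) * (n * (n * n))                         ∎
      where
      eq₁ : ∀ n r D → 2 * (n * (n * r)) + D * (n * n) + (n * (n * n) + n * (n * n))
                      ≡ (2 * r + D) * (n * n) + 2 * (n * (n * n))
      eq₁ = solve-∀

  -- The fourth power of n² < M e would give n⁸ < M⁴e⁴, whereas M⁴e⁴ is at most M⁴ times the
  -- constant times n⁷, hence at most n⁸ for the given n.
  edges-sparse : ∀ M → M * M * (M * M) * (2 * r + D + 2) < n → M * edges ≤ n * n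
  edges-sparse M lt = ℕ.≮⇒≥ λ n²<Me → ℕ.<-irrefl refl (begin-strict
    n * n * (n * n) * (n * n * (n * n))
      <⟨ ℕ.*-mono-< (ℕ.*-mono-< n²<Me n²<Me) (ℕ.*-mono-< n²<Me n²<Me) ⟩
    M * edges * (M * edges) * (M * edges * (M * edges))
      ≡⟨ eq₁ M edges ⟩
    M * M * (M * M) * (edges * edges * (edges * edges))
      ≤⟨ ℕ.*-monoʳ-≤ (M * M * (M * M)) edges⁴≤n⁷ ⟩
    M * M * (M * M) * ((2 * r + D + 2) * (n * n * (n * n) * (n * (n * n))))
      ≡⟨ sym (ℕ.*-assoc (M * M * (M * M)) (2 * r + D + 2) _) ⟩
    M * M * (M * M) * (2 * r + D + 2) * (n * n * (n * n) * (n * (n * n)))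
      ≤⟨ ℕ.*-monoˡ-≤ (n * n * (n * n) * (n * (n * n))) (ℕ.<⇒≤ lt) ⟩
    n * (n * n * (n * n) * (n * (n * n)))
      ≡⟨ eq₂ n ⟩
    n * n * (n * n) * (n * n * (n * n)) ∎)
    where
    open ℕ.≤-Reasoning
    eq₁ : ∀ M e → M * e * (M * e) * (M * e * (M * e)) ≡ M * M * (M * M) * (e * e * (e * e))
    eq₁ = solve-∀
    eq₂ : ∀ n → n * (n * n * (n * n) * (n * (n * n))) ≡ n * n * (n * n) * (n * n * (n * n))
    eq₂ = solve-∀

  -- The error `D * edges` is absorbed by `edges-sparse` with `M = t * D`. The leading term of
  -- `quads≤edges` carries a factor 2, so the 8 labellings leave the denominator 4.
  even-upper : ∀ t → t * D * (t * D) * (t * D * (t * D)) * (2 * r + D + 2) < n →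
               t * (4 * copies (cycle 4) G) ≤ t * (r * n ^ 2) + n ^ 2
  even-upper t lt = ℕ.*-cancelˡ-≤ 2 (begin
    2 * (t * (4 * copies (cycle 4) G))     ≡⟨ eq₁ t (copies (cycle 4) G) ⟩
    t * (8 * copies (cycle 4) G)           ≤⟨ ℕ.*-monoʳ-≤ t (ℕ.≤-trans (Copies.8copies≤quads G) quads≤edges) ⟩
    t * (2 * (n * (n * r)) + D * edges)    ≡⟨ eq₂ t n r D edges ⟩
    2 * (t * (r * (n * n))) + t * D * edges ≤⟨ ℕ.+-monoʳ-≤ _ (edges-sparse (t * D) lt) ⟩
    2 * (t * (r * (n * n))) + n * n        ≤⟨ ℕ.+-monoʳ-≤ _ (ℕ.m≤n*m (n * n) 2) ⟩
    2 * (t * (r * (n * n))) + 2 * (n * n)  ≡⟨ eq₃ t r n ⟩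
    2 * (t * (r * n ^ 2) + n ^ 2)          ∎)
    where
    open ℕ.≤-Reasoning
    eq₁ : ∀ t c → 2 * (t * (4 * c)) ≡ t * (8 * c)
    eq₁ = solve-∀
    eq₂ : ∀ t n r D e → t * (2 * (n * (n * r)) + D * e) ≡ 2 * (t * (r * (n * n))) + t * D * e
    eq₂ = solve-∀
    eq₃ : ∀ t r n → 2 * (t * (r * (n * n))) + 2 * (n * n) ≡ 2 * (t * (r * (n * (n * 1))) + n * (n * 1))
    eq₃ = solve-∀

-- With m = n - s, the number n² exceeds m² - m by at most (2s + 1)n. The bound on `n` makes t s(s -
-- 1) times this excess at most n², and its last summand ensures s ≤ n.
even-lower : ∀ s n t → t * (s * (s ∸ 1)) * (2 * s + 1) + s ≤ n →
  t * (s * (s ∸ 1) * n ^ 2) ≤ t * (4 * copies (cycle 4) (Bipartite.completeBipartite s n)) + n ^ 2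
even-lower s n t N≤n = subst (λ n → t * (s * (s ∸ 1) * n ^ 2) ≤ t * (4 * f) + n ^ 2) s+m≡n (begin
  t * (r * (s + m) ^ 2)
    ≡⟨ eq₁ t r s m ⟩
  t * r * (m * m + s * (m + (s + m)))
    ≤⟨ ℕ.*-monoʳ-≤ (t * r) (ℕ.+-mono-≤ (square≤ m) (ℕ.*-monoʳ-≤ s (ℕ.+-monoˡ-≤ (s + m) (ℕ.m≤n+m m s)))) ⟩
  t * r * (m * m ∸ m + m + s * (s + m + (s + m)))
    ≤⟨ ℕ.*-monoʳ-≤ (t * r) (ℕ.+-monoˡ-≤ _ (ℕ.+-monoʳ-≤ (m * m ∸ m) (ℕ.m≤n+m m s))) ⟩
  t * r * (m * m ∸ m + (s + m) + s * (s + m + (s + m)))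
    ≡⟨ eq₂ t r s (m * m ∸ m) (s + m) ⟩
  t * (r * (m * m ∸ m)) + t * r * (2 * s + 1) * (s + m)
    ≤⟨ ℕ.+-mono-≤ (ℕ.*-monoʳ-≤ t copies≥)
         (ℕ.*-monoˡ-≤ (s + m) (subst (t * r * (2 * s + 1) ≤_) (sym s+m≡n) (ℕ.≤-trans (ℕ.m≤m+n _ s) N≤n))) ⟩
  t * (4 * f) + (s + m) * (s + m)
    ≡⟨ cong (λ x → t * (4 * f) + (s + m) * x) (sym (ℕ.*-identityʳ (s + m))) ⟩
  t * (4 * f) + (s + m) ^ 2 ∎)
  where
  open ℕ.≤-Reasoning
  m r f : ℕ
  m = n ∸ s
  r = s * (s ∸ 1)
  f = copies (cycle 4) (Bipartite.completeBipartite s n)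
  s+m≡n : s + m ≡ n
  s+m≡n = ℕ.m+[n∸m]≡n (ℕ.≤-trans (ℕ.m≤n+m s _) N≤n)
  square≤ : ∀ m → m * m ≤ m * m ∸ m + m
  square≤ m = ℕ.≤-trans (ℕ.m≤n+m∸n (m * m) m) (ℕ.≤-reflexive (ℕ.+-comm m _))
  copies≥ : r * (m * m ∸ m) ≤ 4 * f
  copies≥ = subst (λ x → x * (m * m ∸ m) ≤ 4 * f)
    (sym (trans (ℕ.*-distribˡ-∸ s s 1) (cong (s * s ∸_) (ℕ.*-identityʳ s))))
    (Bipartite.fourCycles≥ s n m s+m≡n)
  eq₁ : ∀ t r s m → t * (r * ((s + m) * ((s + m) * 1))) ≡ t * r * (m * m + s * (m + (s + m)))
  eq₁ = solve-∀
  eq₂ : ∀ t r s x n → t * r * (x + n + s * (n + n)) ≡ t * (r * x) + t * r * (2 * s + 1) * n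
  eq₂ = solve-∀

-- The two bounds when all lengths are odd.

module _ {n a} (G : Graph n) (3≤a : 3 ≤ a) (free : ¬ Contains G (cycle a)) where
  open Quads G using (edges; quads)
  open Triangles G using (triangles; triangles≤; goodman; quads≤edges²)

  private
    C : ℕ
    C = a * a

  triangles≤n² : triangles ≤ C * (n * n)
  triangles≤n² = ℕ.≤-trans (triangles≤ 3≤a free) (ℕ.≤-reflexive (regroup n a))
    where
    regroup : ∀ n a → n * (a * (n * a)) ≡ a * a * (n * n)
    regroup = solve-∀

  -- `goodman` reads 2e² ≤ n²e + Cn³. If the bound failed, n² ≤ 2e would turn Cn³ into at most 2Cne,
  -- and dividing by e would return the bound.
  2edges≤ : 2 * edges ≤ n * n + 2 * C * n
  2edges≤ = ℕ.≮⇒≥ λ lt → many⇒⊥ edges lt (ℕ.≤-trans goodman (ℕ.*-monoʳ-≤ n (ℕ.+-monoʳ-≤ (edges * n) triangles≤n²)))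
    where
    open ℕ.≤-Reasoning
    many⇒⊥ : ∀ e → n * n + 2 * C * n < 2 * e → 2 * (e * e) ≤ n * (e * n + C * (n * n)) → ⊥
    -- The case e = 0 contradicts `lt`; a positive e keeps the multiplication by it strict.
    many⇒⊥ e@(suc _) lt le = ℕ.<-irrefl refl (begin-strict
      (n * n + 2 * C * n) * e                       <⟨ ℕ.*-monoˡ-< e lt ⟩
      2 * e * e                                     ≡⟨ ℕ.*-assoc 2 e e ⟩
      2 * (e * e)                                   ≤⟨ le ⟩
      n * (e * n + C * (n * n))                     ≡⟨ eq₁ n e C ⟩
      n * n * e + C * n * (n * n)
        ≤⟨ ℕ.+-monoʳ-≤ (n * n * e) (ℕ.*-monoʳ-≤ (C * n) (ℕ.≤-trans (ℕ.m≤m+n _ _) (ℕ.<⇒≤ lt))) ⟩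
      n * n * e + C * n * (2 * e)                   ≡⟨ eq₂ n e C ⟩
      (n * n + 2 * C * n) * e                       ∎)
      where
      eq₁ : ∀ n e C → n * (e * n + C * (n * n)) ≡ n * n * e + C * n * (n * n)
      eq₁ = solve-∀
      eq₂ : ∀ n e C → n * n * e + C * n * (2 * e) ≡ (n * n + 2 * C * n) * e
      eq₂ = solve-∀

  -- 64 = 8 · 2 · 4: eight labellings of a copy, the two closings in `quads≤edges²`, and the square
  -- of the 2 in `2edges≤`.
  odd-upper : 64 * copies (cycle 4) G ≤ n ^ 4 + (8 * C + 4 * C * C) * (n * (n * n))
  odd-upper = begin
    64 * copies (cycle 4) G                      ≡⟨ ℕ.*-assoc 8 8 (copies (cycle 4) G) ⟩
    8 * (8 * copies (cycle 4) G)                 ≤⟨ ℕ.*-monoʳ-≤ 8 (Copies.8copies≤quads G) ⟩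
    8 * quads                                    ≡⟨ ℕ.*-assoc 4 2 quads ⟩
    4 * (2 * quads)                              ≤⟨ ℕ.*-monoʳ-≤ 4 quads≤edges² ⟩
    4 * (edges * edges + n * triangles)          ≡⟨ eq₁ edges (n * triangles) ⟩
    2 * edges * (2 * edges) + 4 * (n * triangles)
      ≤⟨ ℕ.+-mono-≤ (ℕ.*-mono-≤ 2edges≤ 2edges≤) (ℕ.*-monoʳ-≤ 4 (ℕ.*-monoʳ-≤ n triangles≤n²)) ⟩
    (n * n + 2 * C * n) * (n * n + 2 * C * n) + 4 * (n * (C * (n * n)))
      ≡⟨ eq₂ n C ⟩
    n ^ 4 + (8 * C * (n * (n * n)) + 4 * C * C * (n * n))
      ≤⟨ ℕ.+-monoʳ-≤ (n ^ 4) (ℕ.+-monoʳ-≤ (8 * C * (n * (n * n))) (ℕ.*-monoʳ-≤ (4 * C * C) (square≤cube n))) ⟩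
    n ^ 4 + (8 * C * (n * (n * n)) + 4 * C * C * (n * (n * n)))
      ≡⟨ cong (_+_ (n ^ 4)) (sym (ℕ.*-distribʳ-+ (n * (n * n)) (8 * C) (4 * C * C))) ⟩
    n ^ 4 + (8 * C + 4 * C * C) * (n * (n * n))  ∎
    where
    open ℕ.≤-Reasoning
    eq₁ : ∀ e x → 4 * (e * e + x) ≡ 2 * e * (2 * e) + 4 * x
    eq₁ = solve-∀
    eq₂ : ∀ n C → (n * n + 2 * C * n) * (n * n + 2 * C * n) + 4 * (n * (C * (n * n)))
                ≡ n * (n * (n * (n * 1))) + (8 * C * (n * (n * n)) + 4 * C * C * (n * n))
    eq₂ = solve-∀

n≤2⌊n/2⌋+1 : ∀ n → n ≤ 2 * ⌊ n /2⌋ + 1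
n≤2⌊n/2⌋+1 zero          = z≤n
n≤2⌊n/2⌋+1 (suc zero)    = ℕ.≤-refl
n≤2⌊n/2⌋+1 (suc (suc n)) = ℕ.≤-trans (s≤s (s≤s (n≤2⌊n/2⌋+1 n))) (ℕ.≤-reflexive (eq ⌊ n /2⌋))
  where
  eq : ∀ h → suc (suc (2 * h + 1)) ≡ 2 * suc h + 1
  eq = solve-∀

-- Each part has u vertices with n ≤ 2u + 1, so n² is at most (2u + 1)² ≤ 4(u² - u) + 8u + 1, and 9n
-- covers 8u + 1. Multiplying out for the two parts gives 153 = 9 · (4 + 4) + 81.
odd-lower : ∀ n → n ^ 4 ≤ 64 * copies (cycle 4) (Bipartite.completeBipartite ⌊ n /2⌋ n) + 153 * (n * (n * n))
odd-lower n = begin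
  n ^ 4                                       ≡⟨ eq₁ n ⟩
  n * n * (n * n)                             ≤⟨ ℕ.*-mono-≤ (half n s s≤n (n≤2⌊n/2⌋+1 n)) (half n m m≤n n≤2m+1) ⟩
  (x + 9 * n) * (y + 9 * n)                   ≡⟨ eq₂ x y n ⟩
  x * y + (9 * n * (x + y) + 81 * (n * n))
    ≤⟨ ℕ.+-mono-≤ xy≤ (ℕ.+-mono-≤ (ℕ.*-monoʳ-≤ (9 * n) (ℕ.+-mono-≤ (small s≤n) (small m≤n)))
         (ℕ.*-monoʳ-≤ 81 (square≤cube n))) ⟩
  64 * f + (9 * n * (4 * (n * n) + 4 * (n * n)) + 81 * (n * (n * n))) ≡⟨ cong (_+_ (64 * f)) (eq₃ n) ⟩
  64 * f + 153 * (n * (n * n))                ∎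
  where
  open ℕ.≤-Reasoning
  s m f x y : ℕ
  s = ⌊ n /2⌋
  m = ⌈ n /2⌉
  f = copies (cycle 4) (Bipartite.completeBipartite s n)
  x = 4 * (s * s ∸ s)
  y = 4 * (m * m ∸ m)
  s≤n : s ≤ n
  s≤n = ℕ.⌊n/2⌋≤n n
  m≤n : m ≤ n
  m≤n = ℕ.⌈n/2⌉≤n n
  n≤2m+1 : n ≤ 2 * m + 1
  n≤2m+1 = ℕ.≤-trans (n≤2⌊n/2⌋+1 n) (ℕ.+-monoˡ-≤ 1 (ℕ.*-monoʳ-≤ 2 (ℕ.⌊n/2⌋≤⌈n/2⌉ n)))
  small : ∀ {u} → u ≤ n → 4 * (u * u ∸ u) ≤ 4 * (n * n)
  small {u} u≤n = ℕ.*-monoʳ-≤ 4 (ℕ.≤-trans (ℕ.m∸n≤m (u * u) u) (ℕ.*-mono-≤ u≤n u≤n))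
  half : ∀ n u → u ≤ n → n ≤ 2 * u + 1 → n * n ≤ 4 * (u * u ∸ u) + 9 * n
  half zero      u u≤n n≤ = z≤n
  half n@(suc _) u u≤n n≤ = begin
    n * n                            ≤⟨ ℕ.*-mono-≤ n≤ n≤ ⟩
    (2 * u + 1) * (2 * u + 1)        ≡⟨ eq u ⟩
    4 * (u * u) + (4 * u + 1)        ≤⟨ ℕ.+-monoˡ-≤ _ (ℕ.*-monoʳ-≤ 4 (ℕ.m≤n+m∸n (u * u) u)) ⟩
    4 * (u + (u * u ∸ u)) + (4 * u + 1) ≡⟨ eq′ u (u * u ∸ u) ⟩
    4 * (u * u ∸ u) + (8 * u + 1)    ≤⟨ ℕ.+-monoʳ-≤ _ (ℕ.+-mono-≤ (ℕ.*-monoʳ-≤ 8 u≤n) (s≤s z≤n)) ⟩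
    4 * (u * u ∸ u) + (8 * n + n)    ≡⟨ cong (_+_ (4 * (u * u ∸ u))) (ℕ.+-comm (8 * n) n) ⟩
    4 * (u * u ∸ u) + 9 * n          ∎
    where
    eq : ∀ u → (2 * u + 1) * (2 * u + 1) ≡ 4 * (u * u) + (4 * u + 1)
    eq = solve-∀
    eq′ : ∀ u z → 4 * (u + z) + (4 * u + 1) ≡ 4 * z + (8 * u + 1)
    eq′ = solve-∀
  xy≤ : x * y ≤ 64 * f
  xy≤ = begin
    x * y                                     ≡⟨ eq (s * s ∸ s) (m * m ∸ m) ⟩
    16 * ((s * s ∸ s) * (m * m ∸ m))
      ≤⟨ ℕ.*-monoʳ-≤ 16 (Bipartite.fourCycles≥ s n m (ℕ.⌊n/2⌋+⌈n/2⌉≡n n)) ⟩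
    16 * (4 * f)                              ≡⟨ sym (ℕ.*-assoc 16 4 f) ⟩
    64 * f                                    ∎
    where
    eq : ∀ x y → 4 * x * (4 * y) ≡ 16 * (x * y)
    eq = solve-∀
  eq₁ : ∀ n → n * (n * (n * (n * 1))) ≡ n * n * (n * n)
  eq₁ = solve-∀
  eq₂ : ∀ x y n → (x + 9 * n) * (y + 9 * n) ≡ x * y + (9 * n * (x + y) + 81 * (n * n))
  eq₂ = solve-∀
  eq₃ : ∀ n → 9 * n * (4 * (n * n) + 4 * (n * n)) + 81 * (n * (n * n)) ≡ 153 * (n * (n * n))
  eq₃ = solve-∀

-- The three statements about the extremal number.

copies-none : ∀ {m} (H : Graph m) (G : Graph n) → ¬ Contains G H → copies H G ≡ 0
copies-none {n} H G none = cong length (List.filter-none (isCopy? H G) {allSubgraphs n}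
  (All.tabulate λ {S} _ c → none (S , c)))

-- The extremal number is the count of an actual free graph, so any property of the counts in graphs
-- without the one cycle `a` passes to it.
ex-upper : ∀ {A : Pred ℕ 0ℓ} {m : ℕ} {H : Graph m} {e a : ℕ} → IsEx n H (cycles A) e → a ∈ A →
           {Bound : ℕ → Set} → (∀ (G : Graph n) → ¬ Contains G (cycle a) → Bound (copies H G)) → Bound e
ex-upper record { attained = G , free , refl } a∈A bound = bound G (free (_ , a∈A))

theorem15 :
    (A : Pred ℕ 0ℓ) → (∀ {a} → a ∈ A → 3 ≤ a) →
    (ex : ℕ → ℕ) → (∀ n → IsEx n (cycle 4) (cycles A) (ex n)) →
    (k : ℕ) → 3 ≤ k →
    (4 ∈ A → ∀ n → ex n ≡ 0)
    × (4 ∉ A → IsLeast (2 * k) (A ∩ Even) →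
         ex ∼ (λ n → (+ ((k ∸ 1) * (k ∸ 2)) / 4) ℚ.* fromℕ (n ^ 2)))
    × (Satisfiable A → Empty (A ∩ Even) →
         ex ∼ (λ n → (+ 1 / 64) ℚ.* fromℕ (n ^ 4)))
theorem15 A A≥3 ex isEx k@(suc (suc (suc k′))) 3≤k@(s≤s (s≤s (s≤s _))) = containing4 , evenLeast , noEven
  where
  open ℕ.≤-Reasoning

  containing4 : 4 ∈ A → ∀ n → ex n ≡ 0
  containing4 4∈A n = ex-upper (isEx n) 4∈A {_≡ 0} (copies-none (cycle 4))

  evenLeast : 4 ∉ A → IsLeast (2 * k) (A ∩ Even) →
              ex ∼ (λ n → (+ ((k ∸ 1) * (k ∸ 2)) / 4) ℚ.* fromℕ (n ^ 2))
  -- `3` encodes the denominator 4. The argument `s≤s z≤n` is where `k ≥ 3` enters: the leading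
  -- coefficient (k - 1)(k - 2) is positive.
  evenLeast _ ((2k∈A , _) , least) = ∼-intro ex r 3 2 (s≤s z≤n) λ t → U t + L t , λ n N≤n →
    ex-upper (isEx n) 2k∈A {λ e → t * (4 * e) ≤ t * (r * n ^ 2) + n ^ 2} (λ G free →
      even-upper G 1≤k free t (ℕ.≤-trans (ℕ.m≤m+n (U t) (L t)) N≤n)) ,
    ℕ.≤-trans (even-lower s n t (ℕ.≤-trans (ℕ.m≤n+m (L t) (U t)) N≤n))
      (ℕ.+-monoˡ-≤ (n ^ 2) (ℕ.*-monoʳ-≤ t (ℕ.*-monoʳ-≤ 4
        (IsEx.maximal (isEx n) (Bipartite.completeBipartite s n) (bipartite-free A≥3 s n long)))))
    where
    1≤k : 1 ≤ k
    1≤k = s≤s z≤n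
    s r D : ℕ
    s = k ∸ 1
    r = (k ∸ 1) * (k ∸ 2)
    D = (k ∸ 1) * (threshold k + threshold k)
    U L : ℕ → ℕ
    U t = suc (t * D * (t * D) * (t * D * (t * D)) * (2 * r + D + 2))
    L t = t * (s * (s ∸ 1)) * (2 * s + 1) + s
    -- Even lengths in `A` are at least 2k, and a left side of k - 1 vertices carries no cycle that
    -- long.
    long : ∀ {t} → t * 2 ∈ A → s < t
    long {t} h = ℕ.*-cancelˡ-≤ 2 (subst (2 * k ≤_) (ℕ.*-comm t 2) (least (h , divides t refl)))

  noEven : Satisfiable A → Empty (A ∩ Even) → ex ∼ (λ n → (+ 1 / 64) ℚ.* fromℕ (n ^ 4))
  -- `63` encodes the denominator 64. Both error terms are constants times n³, and n ≥ t times the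
  -- constant lets n⁴ absorb each of them.
  noEven (a , a∈A) none = ∼-intro ex 1 63 4 ℕ.≤-refl λ t → t * E + t * 153 , λ n N≤n →
    ex-upper (isEx n) a∈A {λ e → t * (64 * e) ≤ t * (1 * n ^ 4) + n ^ 4} (λ G free → begin
      t * (64 * copies (cycle 4) G)           ≤⟨ ℕ.*-monoʳ-≤ t (odd-upper G (A≥3 a∈A) free) ⟩
      t * (n ^ 4 + E * (n * (n * n)))         ≤⟨ absorb t n E (n ^ 4) (ℕ.≤-trans (ℕ.m≤m+n (t * E) _) N≤n) ⟩
      t * n ^ 4 + n ^ 4                       ≡⟨ cong (λ x → t * x + n ^ 4) (sym (ℕ.*-identityˡ (n ^ 4))) ⟩
      t * (1 * n ^ 4) + n ^ 4                 ∎) ,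
    (begin
      t * (1 * n ^ 4)                         ≡⟨ cong (t *_) (ℕ.*-identityˡ (n ^ 4)) ⟩
      t * n ^ 4                               ≤⟨ ℕ.*-monoʳ-≤ t (odd-lower n) ⟩
      t * (64 * copies (cycle 4) (Bipartite.completeBipartite ⌊ n /2⌋ n) + 153 * (n * (n * n)))
        ≤⟨ ℕ.*-monoʳ-≤ t (ℕ.+-monoˡ-≤ _ (ℕ.*-monoʳ-≤ 64 (IsEx.maximal (isEx n) _
             (bipartite-free A≥3 ⌊ n /2⌋ n λ {t} h → contradiction (h , divides t refl) (none _))))) ⟩
      t * (64 * ex n + 153 * (n * (n * n)))   ≤⟨ absorb t n 153 (64 * ex n) (ℕ.≤-trans (ℕ.m≤n+m (t * 153) (t * E)) N≤n) ⟩
      t * (64 * ex n) + n ^ 4                 ∎)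
    where
    E : ℕ
    E = 8 * (a * a) + 4 * (a * a) * (a * a)
    absorb : ∀ t n c x → t * c ≤ n → t * (x + c * (n * (n * n))) ≤ t * x + n ^ 4
    absorb t n c x h = begin
      t * (x + c * (n * (n * n)))      ≡⟨ distribute t n c x ⟩
      t * x + t * c * (n * (n * (n * 1))) ≤⟨ ℕ.+-monoʳ-≤ (t * x) (ℕ.*-monoˡ-≤ (n ^ 3) h) ⟩
      t * x + n ^ 4                    ∎
      where
      distribute : ∀ t n c x → t * (x + c * (n * (n * n))) ≡ t * x + t * c * (n * (n * (n * 1)))
      distribute = solve-∀
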